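{- Let $G$ be a fixed bipartite graph with $|V(G)|=p\ge 3$ vertices and $|E(G)|=q$ edges. Then there exists a constant $C>0$ (depending on $G$) such that for all sufficiently large $n$, \[ \operatorname{br}(G,K_{n,n}) > C\left(\frac{n}{\log n}\right)^{(q-1)/(p-2)}. \]
   Context: For bipartite graphs $G_1,G_2$, the bipartite Ramsey number $\operatorname{br}(G_1,G_2)$ is the smallest integer $N$ such that every red/blue coloring of the edges of the complete bipartite graph $K_{N,N}$ contains a red copy of $G_1$ or a blue copy of $G_2$. $K_{n,n}$ denotes the complete bipartite graph with both parts of size $n$. Rounding (floors/ceilings) is ignored. -}

module Defs where

import Algebra.Definitions.RawSemiring
open import Data.Bool.Base using (Bool; true; false)
open import Data.Empty using (⊥)
open import Data.Fin.Base as Fin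
  using (Fin; zero; suc; toℕ; splitAt; join; _↑ˡ_; _↑ʳ_; combine; finToFun; funToFin)
open import Data.Fin.Properties as Fin
  using (any?; all?; splitAt-join; finToFun-funToFin; toℕ<n; toℕ-injective; ↑ˡ-injective; ↑ʳ-injective)
open import Data.Integer.Base as ℤ using (ℤ)
open import Data.List.Base using (List; []; _∷_; length; filter; allFin; cartesianProduct; lookup)
open import Data.List.Membership.Propositional.Properties using (∈-lookup)
open import Data.List.Properties using (length-tabulate)
open import Data.List.Relation.Unary.All as All using (All; []; _∷_)
open import Data.List.Relation.Unary.All.Properties using (all-filter; filter⁺)
open import Data.List.Relation.Unary.AllPairs using (_∷_)
open import Data.List.Relation.Unary.Unique.Propositional using (Unique)
import Data.List.Relation.Unary.Unique.Propositional.Properties as Unique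
open import Data.Nat.Base as ℕ using (ℕ; zero; suc; NonZero; s≤s; z≤n)
import Data.Nat.Properties as ℕ
open import Data.Product.Base using (Σ; ∃; _×_; _,_; proj₁; proj₂)
open import Data.Rational.Unnormalised.Base as ℚ using (ℚᵘ; 0ℚᵘ; 1ℚᵘ; ↥_; ↧ₙ_)
open import Data.Sum.Base using (_⊎_; inj₁; inj₂; [_,_]′)
open import Data.Sum.Properties using (inj₁-injective; inj₂-injective)
open import Data.Unit.Base using (⊤; tt)
open import Function.Base using (_∘_; id)
open import Function.Definitions using (Injective)
open import Level using (0ℓ)
open import Relation.Binary.Core using (Rel)
open import Relation.Binary.Definitions using (Symmetric; Irreflexive; Decidable; DecidableEquality)
open import Relation.Binary.PropositionalEquality
open import Relation.Nullary.Decidable using (Dec; yes; no; map′; _×-dec_; _⊎-dec_; _→-dec_)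
open import Relation.Nullary.Negation using (¬_; contradiction)
open import Relation.Unary using (Pred)
import Relation.Unary as U
import Relation.Unary.Properties as U

------------------------------------------------------------------------
-- Finite simple graphs

record Graph (n : ℕ) : Set₁ where
  field
    Adj        : Rel (Fin n) 0ℓ
    adj?       : Decidable Adj
    adj-sym    : Symmetric Adj
    adj-irrefl : Irreflexive _≡_ Adj

open Graph using (Adj; adj?)

-- Each edge is counted once, as an adjacent pair (u , v) with u < v.
∣E_∣ : ∀ {n} → Graph n → ℕ
∣E_∣ {n} G = length
  (filter (λ (u , v) → (u Fin.<? v) ×-dec adj? G u v)
          (cartesianProduct (allFin n) (allFin n)))

Bipartite : ∀ {n} → Graph n → Set
Bipartite {n} G = ∃ λ (side : Fin n → Bool) → ∀ u v → Adj G u v → side u ≢ side v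

-- H contains a copy of G as a (not necessarily induced) subgraph.
infix 4 _⊑_
_⊑_ : ∀ {m n} → Graph m → Graph n → Set
_⊑_ {m} {n} G H = ∃ λ (f : Fin m → Fin n) →
  Injective _≡_ _≡_ f × (∀ u v → Adj G u v → Adj H (f u) (f v))

module _ {m n : ℕ} (R : Fin m → Fin n → Set) where

  Across : Rel (Fin m ⊎ Fin n) 0ℓ
  Across (inj₁ i) (inj₂ j) = R i j
  Across (inj₂ j) (inj₁ i) = R i j
  Across (inj₁ _) (inj₁ _) = ⊥
  Across (inj₂ _) (inj₂ _) = ⊥

  -- The bipartite graph with parts Fin m and Fin n, included in Fin (m + n)
  -- by _↑ˡ_ and _↑ʳ_, whose edges are given by R.
  between : (∀ i j → Dec (R i j)) → Graph (m ℕ.+ n)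
  between R? = record
    { Adj        = λ x y → Across (splitAt m x) (splitAt m y)
    ; adj?       = λ x y → across? (splitAt m x) (splitAt m y)
    ; adj-sym    = λ {x} {y} → across-sym (splitAt m x) (splitAt m y)
    ; adj-irrefl = λ { {x} refl → across-irrefl (splitAt m x) }
    }
    where
    across? : Decidable Across
    across? (inj₁ i) (inj₂ j) = R? i j
    across? (inj₂ j) (inj₁ i) = R? i j
    across? (inj₁ _) (inj₁ _) = no λ ()
    across? (inj₂ _) (inj₂ _) = no λ ()

    across-sym : ∀ x y → Across x y → Across y x
    across-sym (inj₁ _) (inj₂ _) r = r
    across-sym (inj₂ _) (inj₁ _) r = r

    across-irrefl : ∀ x → ¬ Across x x
    across-irrefl (inj₁ _) ()
    across-irrefl (inj₂ _) ()

K : ∀ m n → Graph (m ℕ.+ n)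
K m n = between {m} {n} (λ _ _ → ⊤) (λ _ _ → yes tt)

K-bipartite : ∀ m n → Bipartite (K m n)
K-bipartite m n = part ∘ splitAt m , λ u v → ok (splitAt m u) (splitAt m v)
  where
  part : Fin m ⊎ Fin n → Bool
  part (inj₁ _) = true
  part (inj₂ _) = false

  ok : ∀ (x y : Fin m ⊎ Fin n) → Across {m} {n} (λ _ _ → ⊤) x y → part x ≢ part y
  ok (inj₁ _) (inj₂ _) _ ()
  ok (inj₂ _) (inj₁ _) _ ()

------------------------------------------------------------------------
-- Bipartite Ramsey numbers

data Colour : Set where
  red blue : Colour

_≟ᶜ_ : DecidableEquality Colour
red  ≟ᶜ red  = yes refl
red  ≟ᶜ blue = no λ ()
blue ≟ᶜ red  = no λ ()
blue ≟ᶜ blue = yes refl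

-- A colouring of the edges of K N N: the edge joining the i-th vertex of the
-- first part to the j-th vertex of the second has colour c i j.
Colouring : ℕ → Set
Colouring N = Fin N → Fin N → Colour

colourClass : ∀ {N} → Colouring N → Colour → Graph (N ℕ.+ N)
colourClass c k = between (λ i j → c i j ≡ k) (λ i j → c i j ≟ᶜ k)

Arrows : ∀ {p r} → Graph p → Graph r → Pred ℕ 0ℓ
Arrows G H N = (c : Colouring N) → G ⊑ colourClass c red ⊎ H ⊑ colourClass c blue

IsLeast : Pred ℕ 0ℓ → Pred ℕ 0ℓ
IsLeast P N = P N × (∀ M → P M → N ℕ.≤ M)

-- For bipartite G and H some N satisfies Arrows G H N, and Arrows G H is
-- decidable; hence the least such N exists.

private

  find-least : ∀ {P : Pred ℕ 0ℓ} → U.Decidable P → ∀ n → P n → ∃ (IsLeast P)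
  find-least P? zero    P0 = 0 , P0 , λ _ _ → z≤n
  find-least P? (suc n) Pn with P? 0
  ... | yes P0 = 0 , P0 , λ _ _ → z≤n
  ... | no ¬P0 with m , Pm , least ← find-least (P? ∘ suc) n Pn =
    suc m , Pm , λ { zero P0 → contradiction P0 ¬P0 ; (suc k) Pk → s≤s (least k Pk) }

  injective? : ∀ {m n} (f : Fin m → Fin n) → Dec (Injective _≡_ _≡_ f)
  injective? f = map′ (λ h {u} {v} → h u v) (λ h u v → h)
    (all? λ u → all? λ v → (f u Fin.≟ f v) →-dec (u Fin.≟ v))

  ⊑? : ∀ {m n} (G : Graph m) (H : Graph n) → Dec (G ⊑ H)
  ⊑? {m} {n} G H = map′
    (λ (k , h) → finToFun {n} {m} k , h)
    (λ (f , inj , hom) → funToFin f ,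
      (λ {u} {v} eq → inj (trans (sym (finToFun-funToFin f u)) (trans eq (finToFun-funToFin f v)))) ,
      (λ u v a → subst₂ (Adj H) (sym (finToFun-funToFin f u)) (sym (finToFun-funToFin f v)) (hom u v a)))
    (any? λ k → injective? (finToFun {n} {m} k) ×-dec
      all? λ u → all? λ v → adj? G u v →-dec adj? H (finToFun {n} {m} k u) (finToFun {n} {m} k v))

  toColour : Fin 2 → Colour
  toColour zero    = red
  toColour (suc _) = blue

  fromColour : Colour → Fin 2
  fromColour red  = zero
  fromColour blue = suc zero

  to∘from : ∀ k → toColour (fromColour k) ≡ k
  to∘from red  = refl
  to∘from blue = refl

  recolour : ∀ {p N} (G : Graph p) {c d : Colouring N} k → (∀ i j → c i j ≡ d i j) →
             G ⊑ colourClass c k → G ⊑ colourClass d k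
  recolour {N = N} G {c} {d} k eq (f , inj , hom) = f , inj ,
    λ u v a → go (splitAt N (f u)) (splitAt N (f v)) (hom u v a)
    where
    go : ∀ x y → Across (λ i j → c i j ≡ k) x y → Across (λ i j → d i j ≡ k) x y
    go (inj₁ i) (inj₂ j) r = trans (sym (eq i j)) r
    go (inj₂ j) (inj₁ i) r = trans (sym (eq i j)) r

  arrows? : ∀ {p r} (G : Graph p) (H : Graph r) → U.Decidable (Arrows G H)
  arrows? G H N = map′
    (λ h c → [ inj₁ ∘ recolour G red (dec-enc c) , inj₂ ∘ recolour H blue (dec-enc c) ]′ (h (enc c)))
    (λ h k → h (dec k))
    (all? λ k → ⊑? G (colourClass (dec k) red) ⊎-dec ⊑? H (colourClass (dec k) blue))
    where
    dec : Fin (2 ℕ.^ (N ℕ.* N)) → Colouring N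
    dec k i j = toColour (finToFun {2} {N ℕ.* N} k (combine i j))

    enc : Colouring N → Fin (2 ℕ.^ (N ℕ.* N))
    enc c = funToFin {N ℕ.* N} λ x → fromColour (c (Fin.quotient N x) (Fin.remainder {N} N x))

    dec-enc : ∀ c i j → dec (enc c) i j ≡ c i j
    dec-enc c i j = trans (cong toColour (finToFun-funToFin
        (λ x → fromColour (c (Fin.quotient N x) (Fin.remainder {N} N x))) (combine i j)))
      (trans (to∘from _) (cong (λ (a , b) → c a b) (Fin.remQuot-combine i j)))

  length-split : ∀ {A : Set} {P : Pred A 0ℓ} (P? : U.Decidable P) xs →
    length xs ≡ length (filter P? xs) ℕ.+ length (filter (U.∁? P?) xs)
  length-split P? [] = refl
  length-split P? (x ∷ xs) with P? x
  ... | yes _ = cong suc (length-split P? xs)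
  ... | no  _ = trans (cong suc (length-split P? xs)) (sym (ℕ.+-suc _ _))

  pigeonholeᴸ : ∀ {A : Set} (g : A → ℕ) m k (xs : List A) → Unique xs →
    All (λ x → g x ℕ.< k) xs → k ℕ.* m ℕ.< length xs →
    ∃ λ v → v ℕ.< k × ∃ λ ys → Unique ys × All (λ y → g y ≡ v) ys × m ℕ.≤ length ys
  pigeonholeᴸ g m zero (x ∷ xs) _ (() ∷ _) _
  pigeonholeᴸ g m (suc k) xs uniq <k len with m ℕ.≤? length (filter (λ x → g x ℕ.≟ k) xs)
  ... | yes m≤ = k , ℕ.≤-refl , filter (λ x → g x ℕ.≟ k) xs ,
                 Unique.filter⁺ _ uniq , all-filter _ xs , m≤
  ... | no ¬m≤ = let v , v<k , rest = pigeonholeᴸ g m k others (Unique.filter⁺ _ uniq) others<k big in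
                 v , ℕ.m<n⇒m<1+n v<k , rest
    where
    ≟k : U.Decidable (λ x → g x ≡ k)
    ≟k x = g x ℕ.≟ k
    others = filter (U.∁? ≟k) xs
    others<k : All (λ x → g x ℕ.< k) others
    others<k = All.zipWith (λ (lt , ne) → ℕ.≤∧≢⇒< (ℕ.≤-pred lt) ne)
                 (filter⁺ (U.∁? ≟k) <k , all-filter (U.∁? ≟k) xs)
    big : k ℕ.* m ℕ.< length others
    big = ℕ.+-cancelˡ-< m _ _ (ℕ.<-≤-trans len (ℕ.≤-trans
      (ℕ.≤-reflexive (length-split ≟k xs))
      (ℕ.+-monoˡ-≤ (length others) (ℕ.<⇒≤ (ℕ.≰⇒> ¬m≤)))))

  lookup-inj : ∀ {A : Set} {xs : List A} → Unique xs → Injective _≡_ _≡_ (lookup xs)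
  lookup-inj (_ ∷ _)  {zero}  {zero}  _  = refl
  lookup-inj (x∉ ∷ _) {zero}  {suc j} eq = contradiction eq (All.lookup x∉ (∈-lookup j))
  lookup-inj (x∉ ∷ _) {suc i} {zero}  eq = contradiction (sym eq) (All.lookup x∉ (∈-lookup i))
  lookup-inj (_ ∷ u)  {suc i} {suc j} eq = cong suc (lookup-inj u eq)

  pigeonhole : ∀ k m (g : Fin (suc (k ℕ.* m)) → Fin k) →
    ∃ λ v → ∃ λ (f : Fin m → Fin (suc (k ℕ.* m))) → Injective _≡_ _≡_ f × (∀ i → g (f i) ≡ v)
  pigeonhole k m g
    with v , v<k , ys , uniq , all≡ , m≤ ← pigeonholeᴸ (toℕ ∘ g) m k (allFin _) (Unique.allFin⁺ _)
           (All.universal (toℕ<n ∘ g) _) (ℕ.≤-reflexive (sym (length-tabulate id)))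
    = Fin.fromℕ< v<k
    , (λ i → lookup ys (Fin.inject≤ i m≤))
    , (λ eq → Fin.inject≤-injective m≤ m≤ _ _ (lookup-inj uniq eq))
    , (λ i → toℕ-injective (trans (All.lookup all≡ (∈-lookup (Fin.inject≤ i m≤)))
                                  (sym (Fin.toℕ-fromℕ< v<k))))

  MonoK : ∀ {N} → ℕ → Colouring N → Set
  MonoK {N} m c = ∃ λ k → ∃ λ (f : Fin m → Fin N) → ∃ λ (g : Fin m → Fin N) →
    Injective _≡_ _≡_ f × Injective _≡_ _≡_ g × (∀ i j → c (f i) (g j) ≡ k)

  -- Some m second vertices have the same colour pattern towards the first part,
  -- and that pattern is constant on some m first vertices.
  monoK′ : ∀ m {a b} →
    (∀ (h : Fin a → Fin 2) →
      ∃ λ v → ∃ λ (f : Fin m → Fin a) → Injective _≡_ _≡_ f × (∀ i → h (f i) ≡ v)) →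
    (∀ (h : Fin b → Fin (2 ℕ.^ a)) →
      ∃ λ t → ∃ λ (g : Fin m → Fin b) → Injective _≡_ _≡_ g × (∀ j → h (g j) ≡ t)) →
    (c : Colouring (a ℕ.+ b)) → MonoK m c
  monoK′ m {a} {b} choose₁ choose₂ c = fromPattern (choose₂ (funToFin ∘ colours))
    where
    colours : Fin b → Fin a → Fin 2
    colours j i = fromColour (c (i ↑ˡ b) (a ↑ʳ j))

    fromPattern : (∃ λ t → ∃ λ (g : Fin m → Fin b) →
      Injective _≡_ _≡_ g × (∀ j → funToFin (colours (g j)) ≡ t)) → MonoK m c
    fromPattern (t , g , g-inj , g-eq) = fromColourOf (choose₁ (finToFun {2} {a} t))
      where
      fromColourOf : (∃ λ v → ∃ λ (f : Fin m → Fin a) →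
        Injective _≡_ _≡_ f × (∀ i → finToFun {2} {a} t (f i) ≡ v)) → MonoK m c
      fromColourOf (v , f , f-inj , f-eq) =
        toColour v , (λ i → f i ↑ˡ b) , (λ j → a ↑ʳ g j)
        , (λ eq → f-inj (↑ˡ-injective b _ _ eq)) , (λ eq → g-inj (↑ʳ-injective a _ _ eq))
        , λ i j → trans (sym (to∘from _)) (cong toColour (trans
            (sym (finToFun-funToFin (colours (g j)) (f i)))
            (trans (cong (λ t → finToFun {2} {a} t (f i)) (g-eq j)) (f-eq i))))

  monoK : ∀ m → ∃ λ N → (c : Colouring N) → MonoK m c
  monoK m = _ , monoK′ m (pigeonhole 2 m) (pigeonhole (2 ℕ.^ suc (2 ℕ.* m)) m)

  embed : ∀ {p N m} (G : Graph p) → Bipartite G → (ι : Fin p → Fin m) → Injective _≡_ _≡_ ι →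
    (c : Colouring N) (M : MonoK m c) → G ⊑ colourClass c (proj₁ M)
  embed {p} {N} G (side , proper) ι ι-inj c (k , f , g , f-inj , g-inj , mono) =
    join N N ∘ place , place-inj , hom
    where
    at : Bool → Fin p → Fin N ⊎ Fin N
    at true  u = inj₁ (f (ι u))
    at false u = inj₂ (g (ι u))

    place : Fin p → Fin N ⊎ Fin N
    place u = at (side u) u

    at-inj : ∀ s t {u v} → at s u ≡ at t v → u ≡ v
    at-inj true  true  eq = ι-inj (f-inj (inj₁-injective eq))
    at-inj false false eq = ι-inj (g-inj (inj₂-injective eq))

    place-inj : Injective _≡_ _≡_ (join N N ∘ place)
    place-inj {u} {v} eq = at-inj (side u) (side v) (trans (sym (splitAt-join N N (place u)))
      (trans (cong (splitAt N) eq) (splitAt-join N N (place v))))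

    at-adj : ∀ s t u v → s ≢ t → Across (λ i j → c i j ≡ k) (at s u) (at t v)
    at-adj true  false u v _  = mono (ι u) (ι v)
    at-adj false true  u v _  = mono (ι v) (ι u)
    at-adj true  true  u v ne = contradiction refl ne
    at-adj false false u v ne = contradiction refl ne

    hom : ∀ u v → Adj G u v → Adj (colourClass c k) (join N N (place u)) (join N N (place v))
    hom u v a = subst₂ (Across (λ i j → c i j ≡ k))
      (sym (splitAt-join N N (place u))) (sym (splitAt-join N N (place v)))
      (at-adj (side u) (side v) u v (proper u v a))

  arrows : ∀ {p r} (G : Graph p) (H : Graph r) → Bipartite G → Bipartite H →
    ∀ {N} → ((c : Colouring N) → MonoK (p ℕ.+ r) c) → Arrows G H N
  arrows {p} {r} G H bG bH mono c = pick (mono c)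
    where
    pick : MonoK (p ℕ.+ r) c → G ⊑ colourClass c red ⊎ H ⊑ colourClass c blue
    pick M@(red  , _) = inj₁ (embed G bG (_↑ˡ r) (↑ˡ-injective r _ _) c M)
    pick M@(blue , _) = inj₂ (embed H bH (p ↑ʳ_) (↑ʳ-injective p _ _) c M)

abstract

  least-arrows : ∀ {p r} (G : Graph p) (H : Graph r) → Bipartite G → Bipartite H →
                 ∃ (IsLeast (Arrows G H))
  least-arrows {p} {r} G H bG bH = least (monoK (p ℕ.+ r))
    where
    least : (∃ λ N → (c : Colouring N) → MonoK (p ℕ.+ r) c) → ∃ (IsLeast (Arrows G H))
    least (N , mono) = find-least (arrows? G H) N (arrows G H bG bH mono)

br : ∀ {p r} (G : Graph p) (H : Graph r) → Bipartite G → Bipartite H → ℕ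
br G H bG bH = proj₁ (least-arrows G H bG bH)

br-isLeast : ∀ {p r} (G : Graph p) (H : Graph r) (bG : Bipartite G) (bH : Bipartite H) →
             IsLeast (Arrows G H) (br G H bG bH)
br-isLeast G H bG bH = proj₂ (least-arrows G H bG bH)

------------------------------------------------------------------------
-- Positive reals as Dedekind cuts
--
-- Lower x r means 0 < r < x and Upper x r means x < r.  The cut conditions are
-- not part of the record.  All operations below yield the cut of the intended
-- real whenever their arguments are positive, which is how they are used.

record Cut : Set₁ where
  field
    Lower Upper : ℚᵘ → Set

open Cut public

open Algebra.Definitions.RawSemiring ℚ.+-*-rawSemiring public using () renaming (_^_ to _^ℚ_)

infix  4 _<ᶜ_
infixl 7 _*ᶜ_ _÷ᶜ_
infixr 8 _^ℕ_ _^ℤ_ _^_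

_<ᶜ_ : Cut → Cut → Set
x <ᶜ y = ∃ λ r → Upper x r × Lower y r

fromℚ : ℚᵘ → Cut
fromℚ q .Lower r = 0ℚᵘ ℚ.< r × r ℚ.< q
fromℚ q .Upper r = q ℚ.< r

fromℕ : ℕ → Cut
fromℕ n = fromℚ (ℤ.+ n ℚ./ 1)

_*ᶜ_ : Cut → Cut → Cut
(x *ᶜ y) .Lower r = 0ℚᵘ ℚ.< r × ∃ λ s → ∃ λ t → Lower x s × Lower y t × r ℚ.≤ s ℚ.* t
(x *ᶜ y) .Upper r = ∃ λ s → ∃ λ t → Upper x s × Upper y t × s ℚ.* t ℚ.≤ r

_⁻¹ : Cut → Cut
(x ⁻¹) .Lower r = 0ℚᵘ ℚ.< r × ∃ λ s → Upper x s × r ℚ.* s ℚ.≤ 1ℚᵘ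
(x ⁻¹) .Upper r = ∃ λ s → Lower x s × 1ℚᵘ ℚ.≤ r ℚ.* s

_÷ᶜ_ : Cut → Cut → Cut
x ÷ᶜ y = x *ᶜ y ⁻¹

_^ℕ_ : Cut → ℕ → Cut
x ^ℕ zero  = fromℚ 1ℚᵘ
x ^ℕ suc n = x *ᶜ x ^ℕ n

_^ℤ_ : Cut → ℤ → Cut
x ^ℤ ℤ.+ n      = x ^ℕ n
x ^ℤ ℤ.-[1+ n ] = (x ^ℕ suc n) ⁻¹

root : (k : ℕ) .{{_ : NonZero k}} → Cut → Cut
root k x .Lower r = 0ℚᵘ ℚ.< r × Lower x (r ^ℚ k)
root k x .Upper r = 0ℚᵘ ℚ.< r × Upper x (r ^ℚ k)

_^_ : Cut → ℚᵘ → Cut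
x ^ e = root (↧ₙ e) (x ^ℤ ↥ e)

-- (1 + 1/k)^k increases strictly, and (1 + 1/k)^(k+1) decreases strictly, to
-- Euler's number; here k = 1 + i.
e : Cut
e .Lower r = 0ℚᵘ ℚ.< r × ∃ λ i → r ℚ.< (ℤ.+ (2 ℕ.+ i) ℚ./ suc i) ^ℚ suc i
e .Upper r = ∃ λ i → (ℤ.+ (2 ℕ.+ i) ℚ./ suc i) ^ℚ (2 ℕ.+ i) ℚ.< r

-- The natural logarithm as the inverse of r ↦ e ^ r.  It is positive, hence
-- represented by its cut, for n ≥ 2.
log : ℕ → Cut
log n .Lower r = 0ℚᵘ ℚ.< r × e ^ r <ᶜ fromℕ n
log n .Upper r = 0ℚᵘ ℚ.< r × fromℕ n <ᶜ e ^ r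

-- The exponent (q - 1) / (p - 2); it is -1 / (p - 2) when q is 0.
exponent : ∀ {p} → 3 ℕ.≤ p → ℕ → ℚᵘ
exponent {p} 3≤p q = ((ℤ.+ q) ℤ.- (ℤ.+ 1)) ℚ./ (p ℕ.∸ 2)
  where instance
    p∸2≢0 : NonZero (p ℕ.∸ 2)
    p∸2≢0 = ℕ.>-nonZero (ℕ.m<n⇒0<n∸m 3≤p)

{-# OPTIONS --safe #-}

-- Colour each edge of K N N red with probability 1 / (1 + b) and then recolour
-- blue, one after the other, the copies of G that are still entirely red, so
-- that no red copy survives.  If an n × n rectangle T is blue afterwards, then
-- some disjoint copies of G meeting T were red and the rest of T was blue.
-- With μ copies meeting T, summing over the possible families of such copies
-- bounds the probability of this by
--   (1 + b^{-q})^μ (b / (1 + b))^{n²}.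
-- As μ = O(n² N^{p-2}), the first factor is at most the inverse square root of
-- the second one if N^{p-2} ≤ c b^{q-1}, and then a union bound over T succeeds
-- for b = c n / log n.

module Submission where

open import Defs
open import Data.Fin.Base as Fin using (Fin; zero; suc; splitAt; join; combine; remQuot; _↑ˡ_; _↑ʳ_)
import Data.Fin.Properties as Fin
open import Data.Integer.Base as ℤ using (ℤ)
import Data.Integer.Properties as ℤ
open import Data.List.Base
  using (List; []; _∷_; _++_; length; filter; map; concatMap; allFin; cartesianProduct; cartesianProductWith)
open import Data.List.Membership.Propositional using (_∈_; find; lose)
open import Data.List.Membership.Propositional.Properties
  using (∈-map⁺; ∈-++⁺ˡ; ∈-++⁺ʳ; ∈-filter⁺; ∈-allFin; ∈-concatMap⁻; ∈-cartesianProduct⁺; ∈-cartesianProduct⁻;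
         ∈-cartesianProductWith⁺; ∈-cartesianProductWith⁻)
open import Data.List.Properties
  using (length-++; length-map; length-tabulate; length-filter; filter-++; filter-none)
open import Data.List.Relation.Binary.Disjoint.Propositional using (Disjoint)
open import Data.List.Relation.Unary.All as All using (All; []; _∷_)
import Data.List.Relation.Unary.All.Properties as All
open import Data.List.Relation.Unary.AllPairs using (AllPairs; []; _∷_)
import Data.List.Relation.Unary.AllPairs.Properties as AllPairs
open import Data.List.Relation.Unary.Any as Any using (Any; here; there)
open import Data.List.Relation.Unary.Any.Properties using (¬Any[])
open import Data.List.Relation.Unary.Unique.Propositional using (Unique)
import Data.List.Relation.Unary.Unique.Propositional.Properties as Unique
open import Data.Nat.Base as ℕ hiding (_^_; _<_; _/_; _%_)
open import Data.Nat.DivMod using (_/_; _%_; m≡m%n+[m/n]*n; m%n<n; m/n*n≤m; m/n≤m; m≥n⇒m/n>0)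
open import Data.Nat.ListAction using (sum)
open import Data.Nat.Properties
open import Data.Nat.Tactic.RingSolver using (solve-∀)
open import Data.Product.Base using (∃; _×_; _,_; proj₁; proj₂; swap)
open import Data.Rational.Unnormalised.Base as ℚ using (ℚᵘ; mkℚᵘ; 0ℚᵘ; _<_; *<*; *≤*)
open import Data.Sum.Base using (_⊎_; inj₁; inj₂; [_,_]′)
open import Data.Unit.Base using (⊤; tt)
open import Data.Vec.Base using (Vec; []; _∷_; lookup; tabulate; _[_]≔_)
open import Data.Vec.Properties using (lookup∘update; lookup∘update′; lookup∘tabulate)
open import Function.Base using (_∘_; id)
open import Function.Definitions using (Injective)
open import Level using (0ℓ)
open import Relation.Binary.PropositionalEquality
open import Relation.Nullary.Decidable using (Dec; yes; no; _×-dec_; ¬?)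
open import Relation.Nullary.Negation using (¬_; contradiction)
open import Relation.Unary using (Pred; Decidable)

-- Recolouring monochromatic sets

-- Whether a copy is recoloured depends on the earlier recolourings, so these events cannot be
-- multiplied. `φ` avoids this by summing over every subsequence of copies that could have been
-- recoloured. Each erasure is then a change of measure: it sends colourings red on a copy
-- injectively to colourings of `b ^ q` times the weight. Erased copies are blue, so the families
-- counted by `φ` are automatically disjoint. The full list has about N^p copies, too many for the
-- factor (1 + 1/b^q)^μ; hence the full process is compared with the one restricted to copies
-- meeting T.
--
-- All of this happens in natural numbers: expectations are weighted sums of total weight (1 +
-- b)^(N²), inequalities are cross-multiplied, and square roots are avoided by squaring. The integer
-- Δ stands for (1 + 1/b)^(n/2): N² < Δ makes Δ^n outweigh the number of rectangles, and Δ² ≤ (1 +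
-- 1/b)^n lets half of the gain pay for Δ^n. For graphs with an edge the logarithm enters only
-- through 4^ℓ < n, which gives ℓ < log n because 4 > e.

is : Colour → Colour → ℕ
is red  red  = 1
is blue blue = 1
is red  blue = 0
is blue red  = 0

mono : ∀ {k} → Colour → List (Fin k) → Vec Colour k → ℕ
mono κ []      c = 1
mono κ (i ∷ g) c = is κ (lookup c i) * mono κ g c

IsMono : ∀ {k} → Colour → List (Fin k) → Vec Colour k → Set
IsMono κ g c = All (λ i → lookup c i ≡ κ) g

erase : ∀ {k} → List (Fin k) → Vec Colour k → Vec Colour k
erase []      c = c
erase (i ∷ g) c = erase g (c [ i ]≔ blue)

is-refl : ∀ κ → is κ κ ≡ 1
is-refl red  = refl
is-refl blue = refl

IsMono⇒mono≡1 : ∀ {k κ g} {c : Vec Colour k} → IsMono κ g c → mono κ g c ≡ 1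
IsMono⇒mono≡1 [] = refl
IsMono⇒mono≡1 {κ = κ} (eq ∷ m) =
  cong₂ _*_ (trans (cong (is κ) eq) (is-refl κ)) (IsMono⇒mono≡1 m)

mono-update : ∀ {k} κ {i} {g : List (Fin k)} c → All (i ≢_) g →
              mono κ g (c [ i ]≔ blue) ≡ mono κ g c
mono-update κ c [] = refl
mono-update κ c (i≢j ∷ i∉g) =
  cong₂ (λ a m → is κ a * m) (lookup∘update′ (i≢j ∘ sym) c blue) (mono-update κ c i∉g)

lookup-erase : ∀ {k j} (g : List (Fin k)) c → All (j ≢_) g → lookup (erase g c) j ≡ lookup c j
lookup-erase []      c [] = refl
lookup-erase (i ∷ g) c (j≢i ∷ j∉g) =
  trans (lookup-erase g (c [ i ]≔ blue) j∉g) (lookup∘update′ j≢i c blue)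

lookup-erase-blue : ∀ {k j} (g : List (Fin k)) c → lookup c j ≡ blue → lookup (erase g c) j ≡ blue
lookup-erase-blue []      c eq = eq
lookup-erase-blue {j = j} (i ∷ g) c eq = lookup-erase-blue g _ (go (j Fin.≟ i))
  where
  go : Dec (j ≡ i) → lookup (c [ i ]≔ blue) j ≡ blue
  go (yes refl) = lookup∘update i c blue
  go (no j≢i)   = trans (lookup∘update′ j≢i c blue) eq

lookup-erase-∈ : ∀ {k j} (g : List (Fin k)) c → j ∈ g → lookup (erase g c) j ≡ blue
lookup-erase-∈ (i ∷ g) c (here refl) = lookup-erase-blue g _ (lookup∘update i c blue)
lookup-erase-∈ (i ∷ g) c (there j∈g) = lookup-erase-∈ g _ j∈g

module _ {k : ℕ} where

  open import Data.List.Membership.DecPropositional (Fin._≟_ {k}) using (_∈?_)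

  red? : ∀ (g : List (Fin k)) (c : Vec Colour k) → Dec (IsMono red g c)
  red? g c = All.all? (λ i → lookup c i ≟ᶜ red) g

  Meets : List (Fin k) → Pred (List (Fin k)) _
  Meets T g = Any (_∈ T) g

  meets? : ∀ T → Decidable (Meets T)
  meets? T g = Any.any? (_∈? T) g

  erase-if-red : List (Fin k) → Vec Colour k → Vec Colour k
  erase-if-red g c with red? g c
  ... | yes _ = erase g c
  ... | no  _ = c

  clean : List (List (Fin k)) → Vec Colour k → Vec Colour k
  clean []      c = c
  clean (g ∷ L) c = clean L (erase-if-red g c)

  infix 4 _≽_
  -- The invariant linking a run of the full process, on the right, to a run that skips some copies.
  -- As a record it keeps both colourings visible to unification.
  record _≽_ (c c′ : Vec Colour k) : Set where
    constructor redder
    field red-in : ∀ i → lookup c′ i ≡ red → lookup c i ≡ red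

  open _≽_

  ≽-refl : ∀ {c} → c ≽ c
  ≽-refl = redder λ _ eq → eq

  lookup-erase-∉ : ∀ g {i} (c : Vec Colour k) → ¬ i ∈ g → lookup (erase g c) i ≡ lookup c i
  lookup-erase-∉ g c i∉g =
    lookup-erase g c (All.tabulate λ j∈g i≡j → i∉g (subst (_∈ g) (sym i≡j) j∈g))

  ≽-erase : ∀ g {c c′} → c ≽ c′ → c ≽ erase g c′
  ≽-erase g {c} {c′} c≽c′ = redder go
    where
    go : ∀ i → lookup (erase g c′) i ≡ red → lookup c i ≡ red
    go i eq with lookup c′ i in eq′
    ... | red  = red-in c≽c′ i eq′
    ... | blue = contradiction (trans (sym eq) (lookup-erase-blue g c′ eq′)) λ ()

  ≽-erase₂ : ∀ g {c c′} → c ≽ c′ → erase g c ≽ erase g c′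
  ≽-erase₂ g {c} {c′} c≽c′ = redder go
    where
    go : ∀ i → lookup (erase g c′) i ≡ red → lookup (erase g c) i ≡ red
    go i eq with i ∈? g
    ... | yes i∈g = contradiction (trans (sym eq) (lookup-erase-∈ g c′ i∈g)) λ ()
    ... | no  i∉g = trans (lookup-erase-∉ g c i∉g)
      (red-in c≽c′ i (trans (sym (lookup-erase-∉ g c′ i∉g)) eq))

  erase-agree : ∀ g c c′ {i} → lookup c i ≡ lookup c′ i → lookup (erase g c) i ≡ lookup (erase g c′) i
  erase-agree g c c′ {i} eq with i ∈? g
  ... | yes i∈g = trans (lookup-erase-∈ g c i∈g) (sym (lookup-erase-∈ g c′ i∈g))
  ... | no  i∉g = trans (lookup-erase-∉ g c i∉g) (trans eq (sym (lookup-erase-∉ g c′ i∉g)))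

  ≽-erase-if-red : ∀ g {c c′} → c ≽ c′ → c ≽ erase-if-red g c′
  ≽-erase-if-red g {c} {c′} c≽c′ with red? g c′
  ... | yes _ = ≽-erase g c≽c′
  ... | no  _ = c≽c′

  ≽-clean : ∀ L {c c′} → c ≽ c′ → c ≽ clean L c′
  ≽-clean []      c≽c′ = c≽c′
  ≽-clean (g ∷ L) c≽c′ = ≽-clean L (≽-erase-if-red g c≽c′)

  -- Cleaning never creates red, so the state of `g` right after its own turn decides: either some
  -- position was not red, or `g` was erased and, being nonempty, has a blue position.
  clean-not-red : ∀ {L g} c → g ∈ L → 0 ℕ.< length g → ¬ IsMono red g (clean L c)
  clean-not-red {g ∷ L} c (there g∈L) 0<g m = clean-not-red (erase-if-red g c) g∈L 0<g m
  clean-not-red {g@(i ∷ _) ∷ L} c (here refl) 0<g m with red? g c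
  ... | no ¬r = ¬r (All.map (λ {j} → red-in (≽-clean L (≽-refl {c})) j) m)
  ... | yes _ = contradiction
    (trans (sym (lookup-erase-∈ g c (here refl)))
           (red-in (≽-clean L (≽-refl {erase g c})) i (All.head m))) λ ()

  -- Counts the subsequences of L along which successive erasure of red copies
  -- makes T blue.
  φ : List (Fin k) → List (List (Fin k)) → Vec Colour k → ℕ
  φ T []      c = mono blue T c
  φ T (g ∷ L) c = φ T L c + mono red g c * φ T L (erase g c)

  -- Skipping the copies that miss T only leaves more positions red, and none of them in T.
  clean-blue⇒φ : ∀ T L {c c′} → c ≽ c′ → All (λ i → lookup c i ≡ lookup c′ i) T →
                 IsMono blue T (clean L c′) → 1 ≤ φ T (filter (meets? T) L) c
  clean-blue⇒φ T [] c≽c′ agree m =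
    ≤-reflexive (sym (IsMono⇒mono≡1 (All.zipWith (λ (p , q) → trans p q) (agree , m))))
  clean-blue⇒φ T (g ∷ L) {c} {c′} c≽c′ agree m with meets? T g | red? g c′
  ... | yes _ | no _  = ≤-trans (clean-blue⇒φ T L c≽c′ agree m) (m≤m+n _ _)
  -- `c′` follows the full process and `c` the restricted one. Red in `c′` forces red in `c`, so the
  -- branch of `φ` that erases `g` has coefficient 1.
  ... | yes _ | yes r = begin
    1                                  ≤⟨ clean-blue⇒φ T L (≽-erase₂ g c≽c′) (All.map (erase-agree g c c′) agree) m ⟩
    φ T L′ (erase g c)                 ≡⟨ *-identityˡ _ ⟨
    1 * φ T L′ (erase g c)             ≡⟨ cong (_* φ T L′ (erase g c)) (IsMono⇒mono≡1 (All.map (λ {i} → red-in c≽c′ i) r)) ⟨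
    mono red g c * φ T L′ (erase g c)  ≤⟨ m≤n+m _ _ ⟩
    φ T (g ∷ L′) c                     ∎
    where
    open ≤-Reasoning
    L′ = filter (meets? T) L
  ... | no _  | no _  = clean-blue⇒φ T L c≽c′ agree m
  ... | no ¬m | yes r = clean-blue⇒φ T L (≽-erase g c≽c′)
    (All.tabulate λ {i} i∈T → trans (All.lookup agree i∈T)
      (sym (lookup-erase-∉ g c′ λ i∈g → ¬m (Any.map (λ { refl → i∈T }) i∈g))))
    m

-- Weighted sums over colourings and the change of measure

module Weighted (b : ℕ) where

  -- Unnormalised expectation over colourings in which each position is
  -- independently red with probability 1 / (1 + b).
  𝔼 : ∀ {k} → (Vec Colour k → ℕ) → ℕ
  𝔼 {zero}  f = f []
  𝔼 {suc k} f = 𝔼 (f ∘ (red ∷_)) + b * 𝔼 (f ∘ (blue ∷_))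

  𝔼-cong : ∀ {k} {f h : Vec Colour k → ℕ} → (∀ c → f c ≡ h c) → 𝔼 f ≡ 𝔼 h
  𝔼-cong {zero}  eq = eq []
  𝔼-cong {suc k} eq = cong₂ (λ x y → x + b * y) (𝔼-cong (eq ∘ (red ∷_))) (𝔼-cong (eq ∘ (blue ∷_)))

  𝔼-mono : ∀ {k} {f h : Vec Colour k → ℕ} → (∀ c → f c ≤ h c) → 𝔼 f ≤ 𝔼 h
  𝔼-mono {zero}  le = le []
  𝔼-mono {suc k} le = +-mono-≤ (𝔼-mono (le ∘ (red ∷_))) (*-monoʳ-≤ b (𝔼-mono (le ∘ (blue ∷_))))

  𝔼-+ : ∀ {k} (f h : Vec Colour k → ℕ) → 𝔼 (λ c → f c + h c) ≡ 𝔼 f + 𝔼 h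
  𝔼-+ {zero}  f h = refl
  𝔼-+ {suc k} f h rewrite 𝔼-+ (f ∘ (red ∷_)) (h ∘ (red ∷_)) | 𝔼-+ (f ∘ (blue ∷_)) (h ∘ (blue ∷_)) =
    shuffle (𝔼 (f ∘ (red ∷_))) (𝔼 (h ∘ (red ∷_))) _ _ b
    where
    shuffle : ∀ x y z w b → (x + y) + b * (z + w) ≡ (x + b * z) + (y + b * w)
    shuffle = solve-∀

  𝔼-0 : ∀ k → 𝔼 {k} (λ _ → 0) ≡ 0
  𝔼-0 zero = refl
  𝔼-0 (suc k) rewrite 𝔼-0 k = *-zeroʳ b

  𝔼-1 : ∀ k → 𝔼 {k} (λ _ → 1) ≡ suc b ℕ.^ k
  𝔼-1 zero = refl
  𝔼-1 (suc k) rewrite 𝔼-1 k = refl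

  -- First moment method: the deficit persists when the first position is fixed to one of the two
  -- colours, and the recursion follows that colour.
  𝔼-pos : ∀ {k} (f : Vec Colour k → ℕ) → 𝔼 f ℕ.< 𝔼 {k} (λ _ → 1) → ∃ λ c → f c ≡ 0
  𝔼-pos {zero}  f lt = [] , n<1⇒n≡0 lt
  𝔼-pos {suc k} f lt with 𝔼 (f ∘ (red ∷_)) <? 𝔼 {k} (λ _ → 1) | 𝔼 (f ∘ (blue ∷_)) <? 𝔼 {k} (λ _ → 1)
  ... | yes r | _ = let c , eq = 𝔼-pos _ r in red ∷ c , eq
  ... | no _ | yes s = let c , eq = 𝔼-pos _ s in blue ∷ c , eq
  ... | no ¬r | no ¬s = contradiction lt (≤⇒≯ (+-mono-≤ (≮⇒≥ ¬r) (*-monoʳ-≤ b (≮⇒≥ ¬s))))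

  -- Turning position `i` from red to blue is a bijection onto the colourings blue at `i`, and it
  -- multiplies the weight by `b`.
  𝔼-recolour : ∀ {k} (i : Fin k) (f : Vec Colour k → ℕ) →
    b * 𝔼 (λ c → is red (lookup c i) * f (c [ i ]≔ blue)) ≡ 𝔼 (λ c → is blue (lookup c i) * f c)
  𝔼-recolour {suc k} zero f = begin
    b * (𝔼 (λ c → 1 * f (blue ∷ c)) + b * 𝔼 {k} (λ _ → 0))
      ≡⟨ cong (λ z → b * (𝔼 (λ c → 1 * f (blue ∷ c)) + b * z)) (𝔼-0 k) ⟩
    b * (𝔼 (λ c → 1 * f (blue ∷ c)) + b * 0)               ≡⟨ tidy b _ ⟩
    0 + b * 𝔼 (λ c → 1 * f (blue ∷ c))                     ≡⟨ cong (_+ b * 𝔼 (λ c → 1 * f (blue ∷ c))) (𝔼-0 k) ⟨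
    𝔼 {k} (λ _ → 0) + b * 𝔼 (λ c → 1 * f (blue ∷ c))       ∎
    where
    open ≡-Reasoning
    tidy : ∀ b x → b * (x + b * 0) ≡ 0 + b * x
    tidy = solve-∀
  𝔼-recolour {suc k} (suc i) f = trans (*-distribˡ-+ b _ _)
    (cong₂ (λ x y → x + b * y) (𝔼-recolour i (f ∘ (red ∷_))) (𝔼-recolour i (f ∘ (blue ∷_))))

  -- One use of `𝔼-recolour` per position. Uniqueness keeps the red test on the later positions
  -- unaffected; the inequality comes from forgetting that the recoloured positions are now blue.
  𝔼-erase : ∀ {k} {g : List (Fin k)} → Unique g → (f : Vec Colour k → ℕ) →
    b ℕ.^ length g * 𝔼 (λ c → mono red g c * f (erase g c)) ≤ 𝔼 f
  𝔼-erase [] f = ≤-reflexive (trans (*-identityˡ _) (𝔼-cong λ c → *-identityˡ (f c)))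
  𝔼-erase {g = i ∷ g} (i∉g ∷ uniq) f = begin
    b * b ℕ.^ length g * 𝔼 (λ c → mono red (i ∷ g) c * f (erase (i ∷ g) c))
      ≡⟨ cong (b * b ℕ.^ length g *_) (𝔼-cong λ c →
           trans (*-assoc (is red (lookup c i)) _ _)
             (cong (λ m → is red (lookup c i) * (m * f (erase g (c [ i ]≔ blue))))
               (sym (mono-update red c i∉g)))) ⟩
    b * b ℕ.^ length g * 𝔼 (λ c → is red (lookup c i) * h (c [ i ]≔ blue))
      ≡⟨ assoc b (b ℕ.^ length g) _ ⟩
    b ℕ.^ length g * (b * 𝔼 (λ c → is red (lookup c i) * h (c [ i ]≔ blue)))
      ≡⟨ cong (b ℕ.^ length g *_) (𝔼-recolour i h) ⟩
    b ℕ.^ length g * 𝔼 (λ c → is blue (lookup c i) * h c)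
      ≤⟨ *-monoʳ-≤ (b ℕ.^ length g) (𝔼-mono λ c →
           ≤-trans (*-monoˡ-≤ (h c) (is≤1 (lookup c i))) (≤-reflexive (*-identityˡ _))) ⟩
    b ℕ.^ length g * 𝔼 h
      ≤⟨ 𝔼-erase uniq f ⟩
    𝔼 f ∎
    where
    open ≤-Reasoning
    h = λ c → mono red g c * f (erase g c)
    assoc : ∀ x y z → x * y * z ≡ y * (x * z)
    assoc = solve-∀
    is≤1 : ∀ a → is blue a ≤ 1
    is≤1 red  = z≤n
    is≤1 blue = ≤-refl

  -- A copy is either skipped or erased, and by `𝔼-erase` the second option has at most 1/b^q of the
  -- mass of the first, so each copy costs a factor 1 + 1/b^q.
  𝔼-φ : ∀ {k q} T (L : List (List (Fin k))) → All (λ g → Unique g × length g ≡ q) L →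
    (b ℕ.^ q) ℕ.^ length L * 𝔼 (φ T L) ≤ suc (b ℕ.^ q) ℕ.^ length L * 𝔼 (mono blue T)
  𝔼-φ T [] [] = ≤-refl
  𝔼-φ T (g ∷ L) ((uniq , refl) ∷ good) = begin
    x * y * 𝔼 (λ c → φ T L c + mono red g c * φ T L (erase g c))
      ≡⟨ cong (x * y *_) (𝔼-+ (φ T L) _) ⟩
    x * y * (𝔼 (φ T L) + 𝔼 (λ c → mono red g c * φ T L (erase g c)))
      ≡⟨ tidy₁ x y _ _ ⟩
    y * (x * 𝔼 (φ T L) + x * 𝔼 (λ c → mono red g c * φ T L (erase g c)))
      ≤⟨ *-monoʳ-≤ y (+-monoʳ-≤ (x * 𝔼 (φ T L)) (𝔼-erase uniq (φ T L))) ⟩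
    y * (x * 𝔼 (φ T L) + 𝔼 (φ T L))
      ≡⟨ tidy₂ x y _ ⟩
    suc x * (y * 𝔼 (φ T L))
      ≤⟨ *-monoʳ-≤ (suc x) (𝔼-φ T L good) ⟩
    suc x * (suc x ℕ.^ length L * 𝔼 (mono blue T))
      ≡⟨ *-assoc (suc x) (suc x ℕ.^ length L) _ ⟨
    suc x * suc x ℕ.^ length L * 𝔼 (mono blue T) ∎
    where
    open ≤-Reasoning
    x = b ℕ.^ length g
    y = x ℕ.^ length L
    tidy₁ : ∀ x y z w → x * y * (z + w) ≡ y * (x * z + x * w)
    tidy₁ = solve-∀
    tidy₂ : ∀ x y z → y * (x * z + z) ≡ (1 + x) * (y * z)
    tidy₂ = solve-∀

  -- The test on the tail ignores position `i`, so by `𝔼-recolour` the mass with `i` red is 1/b of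
  -- the mass with `i` blue: each position contributes b/(1 + b).
  𝔼-blue : ∀ {k} {T : List (Fin k)} → Unique T →
    suc b ℕ.^ length T * 𝔼 (mono blue T) ≡ b ℕ.^ length T * suc b ℕ.^ k
  𝔼-blue {k} [] = cong (1 *_) (𝔼-1 k)
  𝔼-blue {k} {i ∷ T} (i∉T ∷ uniq) = begin
    suc b * s * 𝔼 (λ c → is blue (lookup c i) * h c)  ≡⟨ tidy₁ b s _ ⟩
    s * (B + b * B)                                   ≡⟨ cong (λ z → s * (z + b * B)) (𝔼-recolour i h) ⟨
    s * (b * 𝔼 (λ c → is red (lookup c i) * h (c [ i ]≔ blue)) + b * B)
      ≡⟨ cong (λ z → s * (b * z + b * B)) (𝔼-cong λ c → cong (is red (lookup c i) *_) (mono-update blue c i∉T)) ⟩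
    s * (b * 𝔼 (λ c → is red (lookup c i) * h c) + b * B)
      ≡⟨ tidy₂ b s _ _ ⟩
    b * (s * (𝔼 (λ c → is red (lookup c i) * h c) + B))
      ≡⟨ cong (λ z → b * (s * z)) (𝔼-+ (λ c → is red (lookup c i) * h c) (λ c → is blue (lookup c i) * h c)) ⟨
    b * (s * 𝔼 (λ c → is red (lookup c i) * h c + is blue (lookup c i) * h c))
      ≡⟨ cong (λ z → b * (s * z)) (𝔼-cong λ c → split (lookup c i) (h c)) ⟩
    b * (s * 𝔼 h)                                     ≡⟨ cong (b *_) (𝔼-blue uniq) ⟩
    b * (b ℕ.^ length T * suc b ℕ.^ k)                    ≡⟨ *-assoc b _ _ ⟨
    b * b ℕ.^ length T * suc b ℕ.^ k ∎
    where
    open ≡-Reasoning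
    s = suc b ℕ.^ length T
    h = mono blue T
    B = 𝔼 (λ c → is blue (lookup c i) * h c)
    split : ∀ a x → is red a * x + is blue a * x ≡ x
    split red  x = trans (+-identityʳ _) (*-identityˡ x)
    split blue x = *-identityˡ x
    tidy₁ : ∀ b s x → (1 + b) * s * x ≡ s * (x + b * x)
    tidy₁ = solve-∀
    tidy₂ : ∀ b s x y → s * (b * x + b * y) ≡ b * (s * (x + y))
    tidy₂ = solve-∀

  𝔼-sum : ∀ {A : Set} {k D W} (F : A → Vec Colour k → ℕ) 𝒯 → All (λ T → D * 𝔼 (F T) ≤ W) 𝒯 →
    D * 𝔼 (λ c → sum (map (λ T → F T c) 𝒯)) ≤ length 𝒯 * W
  𝔼-sum {k = k} {D} F [] [] = ≤-reflexive (trans (cong (D *_) (𝔼-0 k)) (*-zeroʳ D))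
  𝔼-sum {D = D} F (T ∷ 𝒯) (le ∷ les) =
    ≤-trans (≤-reflexive (trans (cong (D *_) (𝔼-+ (F T) _)) (*-distribˡ-+ D _ _)))
      (+-mono-≤ le (𝔼-sum {D = D} F 𝒯 les))

-- Estimates for powers

*-distrib-^ : ∀ x y n → (x * y) ℕ.^ n ≡ x ℕ.^ n * y ℕ.^ n
*-distrib-^ x y zero    = refl
*-distrib-^ x y (suc n) = trans (cong (x * y *_) (*-distrib-^ x y n)) (shuffle x y (x ℕ.^ n) (y ℕ.^ n))
  where
  shuffle : ∀ x y z w → x * y * (z * w) ≡ x * z * (y * w)
  shuffle = solve-∀

square-cancel-≤ : ∀ {x y} → x * x ≤ y * y → x ≤ y
square-cancel-≤ {x} {y} le with x ≤? y
... | yes x≤y = x≤y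
... | no  x≰y = contradiction le (<⇒≱ (*-mono-< (≰⇒> x≰y) (≰⇒> x≰y)))

^-exchange-≤ : ∀ {x y i j} → x ≤ y → i ≤ j → y ℕ.^ i * x ℕ.^ j ≤ y ℕ.^ j * x ℕ.^ i
^-exchange-≤ {x} {y} {i} {j} x≤y i≤j = begin
  y ℕ.^ i * x ℕ.^ j              ≡⟨ cong (λ z → y ℕ.^ i * x ℕ.^ z) (m+[n∸m]≡n i≤j) ⟨
  y ℕ.^ i * x ℕ.^ (i + d)        ≡⟨ cong (y ℕ.^ i *_) (^-distribˡ-+-* x i d) ⟩
  y ℕ.^ i * (x ℕ.^ i * x ℕ.^ d)    ≤⟨ *-monoʳ-≤ (y ℕ.^ i) (*-monoʳ-≤ (x ℕ.^ i) (^-monoˡ-≤ d x≤y)) ⟩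
  y ℕ.^ i * (x ℕ.^ i * y ℕ.^ d)    ≡⟨ shuffle (y ℕ.^ i) (x ℕ.^ i) (y ℕ.^ d) ⟩
  (y ℕ.^ i * y ℕ.^ d) * x ℕ.^ i    ≡⟨ cong (_* x ℕ.^ i) (^-distribˡ-+-* y i d) ⟨
  y ℕ.^ (i + d) * x ℕ.^ i        ≡⟨ cong (λ z → y ℕ.^ z * x ℕ.^ i) (m+[n∸m]≡n i≤j) ⟩
  y ℕ.^ j * x ℕ.^ i              ∎
  where
  open ≤-Reasoning
  d = j ∸ i
  shuffle : ∀ x y z → x * (y * z) ≡ (x * z) * y
  shuffle = solve-∀

-- (1 + 1/x)^m (1 - m/x) ≤ 1
bernoulli : ∀ x m → suc x ℕ.^ m * x ≤ x ℕ.^ m * x + m * suc x ℕ.^ m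
bernoulli x zero    = m≤m+n _ _
bernoulli x (suc m) = begin
  suc x * s * x                                ≡⟨ *-assoc (suc x) s x ⟩
  suc x * (s * x)                              ≤⟨ *-monoʳ-≤ (suc x) (bernoulli x m) ⟩
  suc x * (t * x + m * s)                      ≡⟨ expand x s t m ⟩
  x * t * x + (t * x + m * (suc x * s))        ≤⟨ +-monoʳ-≤ (x * t * x) (+-monoˡ-≤ _
                                                    (*-mono-≤ (^-monoˡ-≤ m (n≤1+n x)) (n≤1+n x))) ⟩
  x * t * x + (s * suc x + m * (suc x * s))    ≡⟨ cong (λ z → x * t * x + (z + m * (suc x * s))) (*-comm s (suc x)) ⟩
  x * t * x + suc m * (suc x * s)              ∎
  where
  open ≤-Reasoning
  s = suc x ℕ.^ m
  t = x ℕ.^ m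
  expand : ∀ x s t m → (1 + x) * (t * x + m * s) ≡ x * t * x + (t * x + m * ((1 + x) * s))
  expand = solve-∀

-- (1 + 1/x)^m ≤ 1 + 1/b
^-ratio-≤ : ∀ x .{{_ : NonZero x}} m b → m * suc b ≤ x → suc x ℕ.^ m * b ≤ x ℕ.^ m * suc b
^-ratio-≤ x m b small = *-cancelʳ-≤ _ _ x (+-cancelʳ-≤ (s * x) _ _ (begin
  s * b * x + s * x                    ≡⟨ t₁ s b x ⟩
  suc b * (s * x)                      ≤⟨ *-monoʳ-≤ (suc b) (bernoulli x m) ⟩
  suc b * (t * x + m * s)              ≡⟨ t₂ s t b x m ⟩
  t * suc b * x + s * (m * suc b)      ≤⟨ +-monoʳ-≤ (t * suc b * x) (*-monoʳ-≤ s small) ⟩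
  t * suc b * x + s * x                ∎))
  where
  open ≤-Reasoning
  s = suc x ℕ.^ m
  t = x ℕ.^ m
  t₁ : ∀ s b x → s * b * x + s * x ≡ (1 + b) * (s * x)
  t₁ = solve-∀
  t₂ : ∀ s t b x m → (1 + b) * (t * x + m * s) ≡ t * (1 + b) * x + s * (m * (1 + b))
  t₂ = solve-∀

-- The union bound for one rectangle, squared so that the factor lost to the copies
-- and the factor gained from the choice of Δ each cost half of (b / (1 + b)) ^ (n * n).
rectangle-bound : ∀ {x b n m ℓ Δ E B W} .{{_ : NonZero x}} →
  x ℕ.^ ℓ * E ≤ suc x ℕ.^ ℓ * B → suc b ℕ.^ (n * n) * B ≡ b ℕ.^ (n * n) * W →
  ℓ + ℓ ≤ m * (n * n) → m * suc b ≤ x → Δ * Δ * b ℕ.^ n ≤ suc b ℕ.^ n →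
  Δ ℕ.^ n * E ≤ W
rectangle-bound {x} {b} {n} {m} {ℓ} {Δ} {E} {B} {W} E≤ B≡ ℓ≤ small Δ≤ =
  *-cancelˡ-≤ (Q * S) {{m*n≢0 Q S {{m^n≢0 x ℓ}} {{m^n≢0 (suc b) (n * n)}}}} (begin
    Q * S * (D * E)       ≡⟨ t₁ Q S D E ⟩
    D * S * (Q * E)       ≤⟨ *-monoʳ-≤ (D * S) E≤ ⟩
    D * S * (R * B)       ≡⟨ t₂ D S R B ⟩
    D * R * (S * B)       ≡⟨ cong (D * R *_) B≡ ⟩
    D * R * (T * W)       ≡⟨ *-assoc (D * R) T W ⟨
    D * R * T * W         ≤⟨ *-monoˡ-≤ W (square-cancel-≤ {D * R * T} {Q * S} squared) ⟩
    Q * S * W             ∎)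
  where
  open ≤-Reasoning
  D = Δ ℕ.^ n
  Q = x ℕ.^ ℓ
  R = suc x ℕ.^ ℓ
  S = suc b ℕ.^ (n * n)
  T = b ℕ.^ (n * n)
  Z = x ℕ.^ (m * (n * n))
  t₁ : ∀ q s d e → q * s * (d * e) ≡ d * s * (q * e)
  t₁ = solve-∀
  t₂ : ∀ d s r b → d * s * (r * b) ≡ d * r * (s * b)
  t₂ = solve-∀
  t₃ : ∀ r t z → r * r * t * z ≡ (r * r) * z * t
  t₃ = solve-∀
  t₄ : ∀ a c t → a * c * t ≡ a * t * c
  t₄ = solve-∀
  t₅ : ∀ z s q → z * s * (q * q) ≡ q * q * s * z
  t₅ = solve-∀
  t₆ : ∀ d r t → d * r * t * (d * r * t) ≡ (d * d * t) * (r * r * t)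
  t₆ = solve-∀
  t₇ : ∀ q s → s * (q * q * s) ≡ q * s * (q * s)
  t₇ = solve-∀
  -- The half of the gain that pays for the choice of the rectangle: the n-th power of Δ² ≤ (1 +
  -- 1/b)^n.
  DDT≤S : D * D * T ≤ S
  DDT≤S = begin
    D * D * T                ≡⟨ cong₂ _*_ (*-distrib-^ Δ Δ n) (^-*-assoc b n n) ⟨
    (Δ * Δ) ℕ.^ n * (b ℕ.^ n) ℕ.^ n ≡⟨ *-distrib-^ (Δ * Δ) (b ℕ.^ n) n ⟨
    (Δ * Δ * b ℕ.^ n) ℕ.^ n      ≤⟨ ^-monoˡ-≤ n Δ≤ ⟩
    (suc b ℕ.^ n) ℕ.^ n          ≡⟨ ^-*-assoc (suc b) n n ⟩
    S                        ∎
  -- The half that pays for the copies: (1 + 1/x)^(2ℓ) ≤ (1 + 1/x)^(m n²) ≤ (1 + 1/b)^(n²). `Z` is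
  -- the denominator of the middle term.
  RRT≤QQS : R * R * T ≤ Q * Q * S
  RRT≤QQS = *-cancelʳ-≤ _ _ Z {{m^n≢0 x (m * (n * n))}} (begin
    R * R * T * Z                                  ≡⟨ t₃ R T Z ⟩
    R * R * Z * T                                  ≡⟨ cong (λ r → r * Z * T) (^-distribˡ-+-* (suc x) ℓ ℓ) ⟨
    suc x ℕ.^ (ℓ + ℓ) * Z * T                        ≤⟨ *-monoˡ-≤ T (^-exchange-≤ (n≤1+n x) ℓ≤) ⟩
    suc x ℕ.^ (m * (n * n)) * x ℕ.^ (ℓ + ℓ) * T        ≡⟨ t₄ (suc x ℕ.^ (m * (n * n))) (x ℕ.^ (ℓ + ℓ)) T ⟩
    suc x ℕ.^ (m * (n * n)) * T * x ℕ.^ (ℓ + ℓ)        ≡⟨ cong (λ z → z * T * x ℕ.^ (ℓ + ℓ)) (^-*-assoc (suc x) m (n * n)) ⟨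
    (suc x ℕ.^ m) ℕ.^ (n * n) * T * x ℕ.^ (ℓ + ℓ)        ≡⟨ cong (_* x ℕ.^ (ℓ + ℓ)) (*-distrib-^ (suc x ℕ.^ m) b (n * n)) ⟨
    (suc x ℕ.^ m * b) ℕ.^ (n * n) * x ℕ.^ (ℓ + ℓ)
      ≤⟨ *-monoˡ-≤ (x ℕ.^ (ℓ + ℓ)) (^-monoˡ-≤ (n * n) (^-ratio-≤ x m b small)) ⟩
    (x ℕ.^ m * suc b) ℕ.^ (n * n) * x ℕ.^ (ℓ + ℓ)        ≡⟨ cong (_* x ℕ.^ (ℓ + ℓ)) (*-distrib-^ (x ℕ.^ m) (suc b) (n * n)) ⟩
    (x ℕ.^ m) ℕ.^ (n * n) * S * x ℕ.^ (ℓ + ℓ)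
      ≡⟨ cong₂ (λ z w → z * S * w) (^-*-assoc x m (n * n)) (^-distribˡ-+-* x ℓ ℓ) ⟩
    Z * S * (Q * Q)                                ≡⟨ t₅ Z S Q ⟩
    Q * Q * S * Z                                  ∎)
  squared : D * R * T * (D * R * T) ≤ Q * S * (Q * S)
  squared = begin
    D * R * T * (D * R * T)    ≡⟨ t₆ D R T ⟩
    (D * D * T) * (R * R * T)  ≤⟨ *-mono-≤ DDT≤S RRT≤QQS ⟩
    S * (Q * Q * S)            ≡⟨ t₇ Q S ⟩
    Q * S * (Q * S)            ∎

-- (1 + m/b) ≤ (1 + 1/b)^m
bernoulli′ : ∀ b m → b ℕ.^ m * b + m * b ℕ.^ m ≤ suc b ℕ.^ m * b
bernoulli′ b zero    = ≤-reflexive (+-identityʳ (1 * b))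
bernoulli′ b (suc m) = begin
  b * y * b + suc m * (b * y)            ≡⟨ regroup b y m ⟩
  b * (y * b + m * y) + y * b            ≤⟨ +-monoʳ-≤ (b * (y * b + m * y)) (m≤m+n (y * b) (m * y)) ⟩
  b * (y * b + m * y) + (y * b + m * y)  ≡⟨ +-comm (b * (y * b + m * y)) _ ⟩
  suc b * (y * b + m * y)                ≤⟨ *-monoʳ-≤ (suc b) (bernoulli′ b m) ⟩
  suc b * (suc b ℕ.^ m * b)                ≡⟨ *-assoc (suc b) (suc b ℕ.^ m) b ⟨
  suc b * suc b ℕ.^ m * b                  ∎
  where
  open ≤-Reasoning
  y = b ℕ.^ m
  regroup : ∀ b y m → b * y * b + (1 + m) * (b * y) ≡ b * (y * b + m * y) + y * b
  regroup = solve-∀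

2*b^b≤[1+b]^b : ∀ b .{{_ : NonZero b}} → 2 * b ℕ.^ b ≤ suc b ℕ.^ b
2*b^b≤[1+b]^b b = *-cancelʳ-≤ _ _ b (begin
  2 * b ℕ.^ b * b          ≡⟨ double (b ℕ.^ b) b ⟩
  b ℕ.^ b * b + b * b ℕ.^ b  ≤⟨ bernoulli′ b b ⟩
  suc b ℕ.^ b * b          ∎)
  where
  open ≤-Reasoning
  double : ∀ x b → 2 * x * b ≡ x * b + b * x
  double = solve-∀

-- Of the n factors 1 + 1/b, every block of `b` is worth at least 2, and the `r` left over are at
-- least 1.
2^d*b^n≤[1+b]^n : ∀ {b d n} .{{_ : NonZero b}} → b * d ≤ n → 2 ℕ.^ d * b ℕ.^ n ≤ suc b ℕ.^ n
2^d*b^n≤[1+b]^n {b} {d} {n} bd≤n = begin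
  2 ℕ.^ d * b ℕ.^ n                      ≡⟨ cong (λ z → 2 ℕ.^ d * b ℕ.^ z) (m+[n∸m]≡n bd≤n) ⟨
  2 ℕ.^ d * b ℕ.^ (b * d + r)            ≡⟨ cong (2 ℕ.^ d *_) (^-distribˡ-+-* b (b * d) r) ⟩
  2 ℕ.^ d * (b ℕ.^ (b * d) * b ℕ.^ r)      ≡⟨ *-assoc (2 ℕ.^ d) _ _ ⟨
  2 ℕ.^ d * b ℕ.^ (b * d) * b ℕ.^ r        ≡⟨ cong (λ z → 2 ℕ.^ d * z * b ℕ.^ r) (^-*-assoc b b d) ⟨
  2 ℕ.^ d * (b ℕ.^ b) ℕ.^ d * b ℕ.^ r        ≡⟨ cong (_* b ℕ.^ r) (*-distrib-^ 2 (b ℕ.^ b) d) ⟨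
  (2 * b ℕ.^ b) ℕ.^ d * b ℕ.^ r            ≤⟨ *-mono-≤ (^-monoˡ-≤ d (2*b^b≤[1+b]^b b)) (^-monoˡ-≤ r (n≤1+n b)) ⟩
  (suc b ℕ.^ b) ℕ.^ d * suc b ℕ.^ r        ≡⟨ cong (_* suc b ℕ.^ r) (^-*-assoc (suc b) b d) ⟩
  suc b ℕ.^ (b * d) * suc b ℕ.^ r        ≡⟨ ^-distribˡ-+-* (suc b) (b * d) r ⟨
  suc b ℕ.^ (b * d + r)                ≡⟨ cong (suc b ℕ.^_) (m+[n∸m]≡n bd≤n) ⟩
  suc b ℕ.^ n                          ∎
  where
  open ≤-Reasoning
  r = n ∸ b * d

-- Choice of the parameters

n<2^n : ∀ n → n ℕ.< 2 ℕ.^ n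
n<2^n zero    = s≤s z≤n
n<2^n (suc n) = begin-strict
  suc n          ≤⟨ n<2^n n ⟩
  2 ℕ.^ n          <⟨ m<m+n (2 ℕ.^ n) {2 ℕ.^ n + 0} (≤-trans (m^n>0 2 n) (m≤m+n _ 0)) ⟩
  2 * 2 ℕ.^ n      ∎
  where open ≤-Reasoning

⌈log₄⌉ : ∀ n → 2 ≤ n → ∃ λ ℓ → 4 ℕ.^ ℓ ℕ.< n × n ≤ 4 ℕ.^ suc ℓ
⌈log₄⌉ (suc zero) (s≤s ())
⌈log₄⌉ (suc (suc zero)) _ = 0 , s≤s (s≤s z≤n) , s≤s (s≤s z≤n)
⌈log₄⌉ (suc n@(suc (suc _))) _ with ⌈log₄⌉ n (s≤s (s≤s z≤n))
... | ℓ , lo , hi with suc n ≤? 4 ℕ.^ suc ℓ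
...   | yes hi′ = ℓ , m<n⇒m<1+n lo , hi′
...   | no  hi′ = suc ℓ , ≰⇒> hi′ , ≤-trans (+-mono-≤ (m^n>0 4 (suc ℓ)) hi)
                    (+-monoʳ-≤ (4 ℕ.^ suc ℓ) (m≤m+n (4 ℕ.^ suc ℓ) _))

1+ℓ²≤4^ℓ : ∀ ℓ → suc ℓ * suc ℓ ≤ 4 ℕ.^ ℓ
1+ℓ²≤4^ℓ ℓ = ≤-trans (*-mono-≤ (n<2^n ℓ) (n<2^n ℓ)) (≤-reflexive (sym (*-distrib-^ 2 2 ℓ)))

-- b is of order n / log n; an edge will be red with probability 1 / (1 + b).
record Parameters (q n : ℕ) : Set where
  field
    ℓ b Δ : ℕ
    ℓ>0   : 0 ℕ.< ℓ
    4^ℓ<n : 4 ℕ.^ ℓ ℕ.< n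
    b>0   : 0 ℕ.< b
    -- Here `q` is one less than the number of edges. With ℓ < log n this gives n / log n < 32 (q +
    -- 1) b.
    n<    : suc n ≤ 32 * suc q * b * ℓ
    Δ>    : ∀ N → N ≤ b ℕ.^ q → N * N ℕ.< Δ
    Δ≤    : Δ * Δ * b ℕ.^ n ≤ suc b ℕ.^ n

-- The choice b = n / d gives (1 + 1/b)^n ≥ 2^d, and Δ = 2^h with d = 2h uses all of it. As N ≤ b^q
-- ≤ 4^((ℓ + 1) q), N² is at most 2^(4 (ℓ + 1) q); `suc q` instead of `q` in `h` makes N² < Δ
-- strict. The threshold on `n` forces 8 (q + 1) ≤ ℓ, hence d ≤ (ℓ + 1)² ≤ 4^ℓ < n and b > 0.
parameters : ∀ q n → 4 ℕ.^ (8 * suc q) ℕ.< n → Parameters q n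
parameters q n big with ⌈log₄⌉ n (≤-trans (s≤s (m^n>0 4 (8 * suc q))) big)
... | ℓ , lo , hi = record
  { ℓ = ℓ ; b = b ; Δ = 2 ℕ.^ h ; ℓ>0 = ℓ>0 ; 4^ℓ<n = lo ; b>0 = b>0
  ; n< = n< ; Δ> = Δ> ; Δ≤ = Δ≤ }
  where
  open ≤-Reasoning
  h = 4 * suc ℓ * suc q
  d = 8 * suc ℓ * suc q

  8q≤ℓ : 8 * suc q ≤ ℓ
  8q≤ℓ with 8 * suc q ≤? ℓ
  ... | yes le = le
  ... | no  gt = contradiction (<-≤-trans big hi) (≤⇒≯ (^-monoʳ-≤ 4 (≰⇒> gt)))

  ℓ>0 : 0 ℕ.< ℓ
  ℓ>0 = ≤-trans (s≤s z≤n) 8q≤ℓ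

  d≤n : d ≤ n
  d≤n = begin
    8 * suc ℓ * suc q    ≡⟨ commute (suc ℓ) (suc q) ⟩
    8 * suc q * suc ℓ    ≤⟨ *-monoˡ-≤ (suc ℓ) (m≤n⇒m≤1+n 8q≤ℓ) ⟩
    suc ℓ * suc ℓ        ≤⟨ 1+ℓ²≤4^ℓ ℓ ⟩
    4 ℕ.^ ℓ                ≤⟨ <⇒≤ lo ⟩
    n                    ∎
    where
    commute : ∀ x y → 8 * x * y ≡ 8 * y * x
    commute = solve-∀

  b : ℕ
  b = n / d

  b>0 : 0 ℕ.< b
  b>0 = m≥n⇒m/n>0 d≤n

  n< : suc n ≤ 32 * suc q * b * ℓ
  n< = begin
    suc n                            ≡⟨ cong suc (m≡m%n+[m/n]*n n d) ⟩
    suc (n % d) + b * d              ≤⟨ +-monoˡ-≤ (b * d) (m%n<n n d) ⟩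
    -- The constant 32 is 2 · 8 · 2, from b + 1 ≤ 2b and ℓ + 1 ≤ 2ℓ.
    suc b * d                        ≤⟨ *-mono-≤ (+-monoˡ-≤ b b>0)
                                          (*-monoˡ-≤ (suc q) (*-monoʳ-≤ 8 (+-monoˡ-≤ ℓ ℓ>0))) ⟩
    (b + b) * (8 * (ℓ + ℓ) * suc q)  ≡⟨ regroup b ℓ (suc q) ⟩
    32 * suc q * b * ℓ               ∎
    where
    regroup : ∀ b ℓ q → (b + b) * (8 * (ℓ + ℓ) * q) ≡ 32 * q * b * ℓ
    regroup = solve-∀

  Δ≤ : 2 ℕ.^ h * 2 ℕ.^ h * b ℕ.^ n ≤ suc b ℕ.^ n
  Δ≤ = begin
    2 ℕ.^ h * 2 ℕ.^ h * b ℕ.^ n  ≡⟨ cong (_* b ℕ.^ n) (^-distribˡ-+-* 2 h h) ⟨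
    2 ℕ.^ (h + h) * b ℕ.^ n    ≡⟨ cong (λ z → 2 ℕ.^ z * b ℕ.^ n) (double (suc ℓ) (suc q)) ⟩
    2 ℕ.^ d * b ℕ.^ n          ≤⟨ 2^d*b^n≤[1+b]^n {b} {d} {{>-nonZero b>0}} (m/n*n≤m n d) ⟩
    suc b ℕ.^ n              ∎
    where
    double : ∀ x y → 4 * x * y + 4 * x * y ≡ 8 * x * y
    double = solve-∀

  Δ> : ∀ N → N ≤ b ℕ.^ q → N * N ℕ.< 2 ℕ.^ h
  Δ> N N≤ = begin-strict
    N * N                                      ≤⟨ *-mono-≤ N≤4^ N≤4^ ⟩
    4 ℕ.^ (suc ℓ * q) * 4 ℕ.^ (suc ℓ * q)          ≡⟨ cong (λ z → z * z) (*-distrib-^ 2 2 (suc ℓ * q)) ⟩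
    2 ℕ.^ k * 2 ℕ.^ k * (2 ℕ.^ k * 2 ℕ.^ k)            ≡⟨ cong (λ z → z * z) (^-distribˡ-+-* 2 k k) ⟨
    2 ℕ.^ (k + k) * 2 ℕ.^ (k + k)                  ≡⟨ ^-distribˡ-+-* 2 (k + k) (k + k) ⟨
    2 ℕ.^ (k + k + (k + k))                      <⟨ ^-monoʳ-< 2 (s≤s (s≤s z≤n)) exponents ⟩
    2 ℕ.^ h                                      ∎
    where
    k = suc ℓ * q
    N≤4^ : N ≤ 4 ℕ.^ (suc ℓ * q)
    N≤4^ = begin
      N                  ≤⟨ N≤ ⟩
      b ℕ.^ q              ≤⟨ ^-monoˡ-≤ q (≤-trans (m/n≤m n d) hi) ⟩
      (4 ℕ.^ suc ℓ) ℕ.^ q    ≡⟨ ^-*-assoc 4 (suc ℓ) q ⟩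
      4 ℕ.^ (suc ℓ * q)    ∎
    quadruple : ∀ x y → 4 * x * (1 + y) ≡ 4 * x + (x * y + x * y + (x * y + x * y))
    quadruple = solve-∀
    exponents : k + k + (k + k) ℕ.< h
    exponents = ≤-trans (+-monoˡ-≤ (k + k + (k + k)) {1} {4 * suc ℓ} (s≤s z≤n)) (≤-reflexive (sym (quadruple (suc ℓ) q)))

-- Copies of G and rectangles in K N N

module _ {A : Set} where

  length-filter-⊎ : ∀ {P Q R : Pred A 0ℓ} (P? : Decidable P) (Q? : Decidable Q) (R? : Decidable R) →
    (∀ {x} → P x → Q x ⊎ R x) → ∀ xs →
    length (filter P? xs) ≤ length (filter Q? xs) + length (filter R? xs)
  length-filter-⊎ P? Q? R? P⊆ [] = z≤n
  length-filter-⊎ P? Q? R? P⊆ (x ∷ xs) with ih ← length-filter-⊎ P? Q? R? P⊆ xs | P? x | Q? x | R? x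
  ... | yes p | no ¬q | no ¬r = contradiction (P⊆ p) [ ¬q , ¬r ]′
  ... | yes p | yes q | yes r = s≤s (≤-trans ih (+-monoʳ-≤ _ (n≤1+n _)))
  ... | yes p | yes q | no ¬r = s≤s ih
  ... | yes p | no ¬q | yes r = ≤-trans (s≤s ih) (≤-reflexive (sym (+-suc _ _)))
  ... | no ¬p | yes q | yes r = m≤n⇒m≤1+n (≤-trans ih (+-monoʳ-≤ _ (n≤1+n _)))
  ... | no ¬p | yes q | no ¬r = m≤n⇒m≤1+n ih
  ... | no ¬p | no ¬q | yes r = ≤-trans ih (+-monoʳ-≤ _ (n≤1+n _))
  ... | no ¬p | no ¬q | no ¬r = ih

  length-filter-Any : ∀ {I : Set} {P : Pred A 0ℓ} {Q : I → Pred A 0ℓ} {B}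
    (P? : Decidable P) (Q? : ∀ k → Decidable (Q k)) {ks : List I} xs →
    (∀ {x} → P x → Any (λ k → Q k x) ks) → All (λ k → length (filter (Q? k) xs) ≤ B) ks →
    length (filter P? xs) ≤ length ks * B
  length-filter-Any P? Q? {[]} xs P⊆ [] =
    ≤-reflexive (cong length (filter-none P? (All.universal (λ _ p → ¬Any[] (P⊆ p)) xs)))
  length-filter-Any {Q = Q} P? Q? {k ∷ ks} xs P⊆ (le ∷ les) = ≤-trans
    (length-filter-⊎ P? (Q? k) (λ x → P? x ×-dec ¬? (Q? k x)) split xs)
    (+-mono-≤ le (length-filter-Any (λ x → P? x ×-dec ¬? (Q? k x)) Q? xs
      (λ (p , ¬q) → Any.tail ¬q (P⊆ p)) les))
    where
    split : ∀ {x} → _ → Q k x ⊎ _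
    split {x} p with Q? k x
    ... | yes q = inj₁ q
    ... | no ¬q = inj₂ (p , ¬q)

  length-filter-filter : ∀ {P Q : Pred A 0ℓ} (P? : Decidable P) (Q? : Decidable Q) xs →
    length (filter P? (filter Q? xs)) ≤ length (filter P? xs)
  length-filter-filter P? Q? [] = z≤n
  length-filter-filter P? Q? (x ∷ xs) with ih ← length-filter-filter P? Q? xs | Q? x
  ... | yes _ with P? x
  ...   | yes _ = s≤s ih
  ...   | no _  = ih
  length-filter-filter P? Q? (x ∷ xs) | no _ with P? x
  ...   | yes _ = m≤n⇒m≤1+n ih
  ...   | no _  = ih

  length-filter-map : ∀ {B : Set} {P : Pred A 0ℓ} (P? : Decidable P) (f : B → A) xs →
    length (filter P? (map f xs)) ≡ length (filter (P? ∘ f) xs)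
  length-filter-map P? f [] = refl
  length-filter-map P? f (x ∷ xs) with P? (f x)
  ... | yes _ = cong suc (length-filter-map P? f xs)
  ... | no  _ = length-filter-map P? f xs

  length-cartesianProductWith : ∀ {B C : Set} (f : A → B → C) xs ys →
    length (cartesianProductWith f xs ys) ≡ length xs * length ys
  length-cartesianProductWith f []       ys = refl
  length-cartesianProductWith f (x ∷ xs) ys = trans (length-++ (map (f x) ys))
    (cong₂ _+_ (length-map (f x) ys) (length-cartesianProductWith f xs ys))

words : ∀ M m → List (Vec (Fin M) m)
words M zero    = [] ∷ []
words M (suc m) = cartesianProductWith _∷_ (allFin M) (words M m)

module _ {M : ℕ} where

  length-words : ∀ m → length (words M m) ≡ M ℕ.^ m
  length-words zero    = refl
  length-words (suc m) = trans (length-cartesianProductWith _∷_ (allFin M) (words M m))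
    (cong₂ _*_ (length-tabulate {n = M} id) (length-words m))

  ∈-words : ∀ {m} (v : Vec (Fin M) m) → v ∈ words M m
  ∈-words []      = here refl
  ∈-words (x ∷ v) = ∈-cartesianProductWith⁺ _∷_ (∈-allFin x) (∈-words v)

  module _ {m} {P : Pred (Vec (Fin M) (suc m)) 0ℓ} (P? : Decidable P) (vs : List (Vec (Fin M) m)) where

    private
      count : List (Fin M) → ℕ
      count xs = length (filter P? (cartesianProductWith _∷_ xs vs))

      count-∷ : ∀ x xs → count (x ∷ xs) ≡ length (filter (P? ∘ (x ∷_)) vs) + count xs
      count-∷ x xs = trans (cong length (filter-++ P? (map (x ∷_) vs) _))
        (trans (length-++ (filter P? (map (x ∷_) vs)))
          (cong (_+ count xs) (length-filter-map P? (x ∷_) vs)))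

    length-filter-∷ : ∀ {B} → (∀ x → length (filter (P? ∘ (x ∷_)) vs) ≤ B) →
      ∀ xs → count xs ≤ length xs * B
    length-filter-∷ le []       = z≤n
    length-filter-∷ le (x ∷ xs) =
      ≤-trans (≤-reflexive (count-∷ x xs)) (+-mono-≤ (le x) (length-filter-∷ le xs))

    length-filter-head : ∀ {x} → (∀ {y v} → P (y ∷ v) → y ≡ x) → ∀ {xs} → Unique xs →
      count xs ≤ length (filter (P? ∘ (x ∷_)) vs)
    length-filter-head only [] = z≤n
    length-filter-head {x} only {y ∷ xs} (y∉xs ∷ uniq) with y Fin.≟ x
    ... | yes refl = ≤-reflexive (trans (count-∷ y xs) (trans (cong (_ +_) (absent xs y∉xs)) (+-identityʳ _)))
      where
      absent : ∀ xs → All (y ≢_) xs → count xs ≡ 0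
      absent []       []          = refl
      absent (z ∷ xs) (y≢z ∷ y∉xs) = trans (count-∷ z xs) (cong₂ _+_
        (cong length (filter-none (P? ∘ (z ∷_)) (All.universal (λ v p → y≢z (sym (only p))) vs)))
        (absent xs y∉xs))
    ... | no y≢x = ≤-trans
      (≤-reflexive (trans (count-∷ y xs) (cong (_+ count xs)
        (cong length (filter-none (P? ∘ (y ∷_)) (All.universal (λ v p → y≢x (only p)) vs))))))
      (length-filter-head only uniq)

  length-filter-lookup : ∀ {m} {P : Pred (Vec (Fin M) (suc m)) 0ℓ} (P? : Decidable P) u {x} →
    (∀ {v} → P v → lookup v u ≡ x) → length (filter P? (words M (suc m))) ≤ M ℕ.^ m
  length-filter-lookup {m} P? zero P⊆ = ≤-trans
    (length-filter-head P? (words M m) P⊆ (Unique.allFin⁺ M))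
    (≤-trans (length-filter (P? ∘ (_ ∷_)) (words M m)) (≤-reflexive (length-words m)))
  length-filter-lookup {suc m} P? (suc u) P⊆ = ≤-trans
    (length-filter-∷ P? (words M (suc m)) (λ x → length-filter-lookup (P? ∘ (x ∷_)) u P⊆) (allFin M))
    (≤-reflexive (cong (_* M ℕ.^ m) (length-tabulate {n = M} id)))

  -- Two coordinates are prescribed and `m` stay free: the source of the exponent p - 2.
  length-filter-lookup₂ : ∀ {m} {P : Pred (Vec (Fin M) (2 + m)) 0ℓ} (P? : Decidable P) {u w x y} →
    u ≢ w → (∀ {v} → P v → lookup v u ≡ x × lookup v w ≡ y) →
    length (filter P? (words M (2 + m))) ≤ M ℕ.^ m
  length-filter-lookup₂ P? {zero} {zero} u≢w P⊆ = contradiction refl u≢w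
  length-filter-lookup₂ {m} P? {zero} {suc w} u≢w P⊆ = ≤-trans
    (length-filter-head P? (words M (suc m)) (proj₁ ∘ P⊆) (Unique.allFin⁺ M))
    (length-filter-lookup (P? ∘ (_ ∷_)) w (proj₂ ∘ P⊆))
  length-filter-lookup₂ {m} P? {suc u} {zero} u≢w P⊆ = ≤-trans
    (length-filter-head P? (words M (suc m)) (proj₂ ∘ P⊆) (Unique.allFin⁺ M))
    (length-filter-lookup (P? ∘ (_ ∷_)) u (proj₁ ∘ P⊆))
  length-filter-lookup₂ {zero} P? {suc zero} {suc zero} u≢w P⊆ = contradiction refl u≢w
  length-filter-lookup₂ {suc m} P? {suc u} {suc w} u≢w P⊆ = ≤-trans
    (length-filter-∷ P? (words M (2 + m))
      (λ x → length-filter-lookup₂ (P? ∘ (x ∷_)) (u≢w ∘ cong suc) P⊆) (allFin M))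
    (≤-reflexive (cong (_* M ℕ.^ m) (length-tabulate {n = M} id)))

module Cells (N : ℕ) where

  splitAt-injective : ∀ {x y : Fin (N + N)} → splitAt N x ≡ splitAt N y → x ≡ y
  splitAt-injective {x} {y} eq =
    trans (sym (Fin.join-splitAt N N x)) (trans (cong (join N N) eq) (Fin.join-splitAt N N y))

  colouring : Vec Colour (N * N) → Colouring N
  colouring c i j = lookup c (combine i j)

  -- A list of at most one position, empty for two vertices of the same part, so that `copy` makes
  -- sense for every map of vertices.
  cell : Fin N ⊎ Fin N → Fin N ⊎ Fin N → List (Fin (N * N))
  cell (inj₁ i) (inj₂ j) = combine i j ∷ []
  cell (inj₂ j) (inj₁ i) = combine i j ∷ []
  cell (inj₁ _) (inj₁ _) = []
  cell (inj₂ _) (inj₂ _) = []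

  unique-cell : ∀ x y → Unique (cell x y)
  unique-cell (inj₁ _) (inj₂ _) = [] ∷ []
  unique-cell (inj₂ _) (inj₁ _) = [] ∷ []
  unique-cell (inj₁ _) (inj₁ _) = []
  unique-cell (inj₂ _) (inj₂ _) = []

  length-cell : ∀ {R} x y → Across {N} {N} R x y → length (cell x y) ≡ 1
  length-cell (inj₁ _) (inj₂ _) _ = refl
  length-cell (inj₂ _) (inj₁ _) _ = refl

  cell-red : ∀ {c} x y → Across (λ i j → colouring c i j ≡ red) x y → IsMono red (cell x y) c
  cell-red (inj₁ _) (inj₂ _) r = r ∷ []
  cell-red (inj₂ _) (inj₁ _) r = r ∷ []

  cell-injective : ∀ x y x′ y′ {t} → t ∈ cell x y → t ∈ cell x′ y′ →
    (x ≡ x′ × y ≡ y′) ⊎ (x ≡ y′ × y ≡ x′)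
  cell-injective (inj₁ i) (inj₂ j) (inj₁ i′) (inj₂ j′) (here refl) (here eq)
    with refl , refl ← Fin.combine-injective i j i′ j′ eq = inj₁ (refl , refl)
  cell-injective (inj₁ i) (inj₂ j) (inj₂ j′) (inj₁ i′) (here refl) (here eq)
    with refl , refl ← Fin.combine-injective i j i′ j′ eq = inj₂ (refl , refl)
  cell-injective (inj₂ j) (inj₁ i) (inj₁ i′) (inj₂ j′) (here refl) (here eq)
    with refl , refl ← Fin.combine-injective i j i′ j′ eq = inj₂ (refl , refl)
  cell-injective (inj₂ j) (inj₁ i) (inj₂ j′) (inj₁ i′) (here refl) (here eq)
    with refl , refl ← Fin.combine-injective i j i′ j′ eq = inj₁ (refl , refl)

  ends : Fin (N * N) → Fin (N + N) × Fin (N + N)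
  ends t = let i , j = remQuot N t in i ↑ˡ N , N ↑ʳ j

  -- Both orientations occur, since the smaller end of an edge of G may land in either part.
  orientedEnds : List (Fin (N * N)) → List (Fin (N + N) × Fin (N + N))
  orientedEnds T = map ends T ++ map (swap ∘ ends) T

  length-orientedEnds : ∀ T → length (orientedEnds T) ≡ length T + length T
  length-orientedEnds T = trans (length-++ (map ends T))
    (cong₂ _+_ (length-map ends T) (length-map (swap ∘ ends) T))

  ends-combine : ∀ i j → ends (combine i j) ≡ (i ↑ˡ N , N ↑ʳ j)
  ends-combine i j = cong (λ (i , j) → i ↑ˡ N , N ↑ʳ j) (Fin.remQuot-combine i j)

  ∈-cell⇒∈-orientedEnds : ∀ {T t} x y → t ∈ cell (splitAt N x) (splitAt N y) → t ∈ T →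
    (x , y) ∈ orientedEnds T
  ∈-cell⇒∈-orientedEnds {T} x y t∈cell t∈T with splitAt N x in eqx | splitAt N y in eqy
  ∈-cell⇒∈-orientedEnds {T} x y (here refl) t∈T | inj₁ i | inj₂ j =
    ∈-++⁺ˡ (subst (_∈ map ends T)
      (trans (ends-combine i j) (cong₂ _,_ (Fin.splitAt⁻¹-↑ˡ eqx) (Fin.splitAt⁻¹-↑ʳ eqy)))
      (∈-map⁺ ends t∈T))
  ∈-cell⇒∈-orientedEnds {T} x y (here refl) t∈T | inj₂ j | inj₁ i =
    ∈-++⁺ʳ (map ends T) (subst (_∈ map (swap ∘ ends) T)
      (trans (cong swap (ends-combine i j)) (cong₂ _,_ (Fin.splitAt⁻¹-↑ʳ eqx) (Fin.splitAt⁻¹-↑ˡ eqy)))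
      (∈-map⁺ (swap ∘ ends) t∈T))

module _ {k : ℕ} where

  open import Data.List.Relation.Unary.Unique.DecPropositional (Fin._≟_ {k}) using (unique?)

  Simple : ℕ → Pred (List (Fin k)) 0ℓ
  Simple ℓ g = Unique g × length g ≡ ℓ

  simple? : ∀ ℓ → Decidable (Simple ℓ)
  simple? ℓ g = unique? g ×-dec (length g ≟ ℓ)

module Copies {p : ℕ} (G : Graph p) (N : ℕ) where

  open Graph G
  open Cells N

  edges : List (Fin p × Fin p)
  edges = filter (λ (u , v) → (u Fin.<? v) ×-dec adj? u v) (cartesianProduct (allFin p) (allFin p))

  edges-adj : All (λ (u , v) → u Fin.< v × Adj u v) edges
  edges-adj = All.all-filter _ (cartesianProduct (allFin p) (allFin p))

  edges-unique : Unique edges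
  edges-unique = Unique.filter⁺ _ (Unique.cartesianProduct⁺ (Unique.allFin⁺ p) (Unique.allFin⁺ p))

  side : Vec (Fin (N + N)) p → Fin p → Fin N ⊎ Fin N
  side v u = splitAt N (lookup v u)

  image : Vec (Fin (N + N)) p → Fin p × Fin p → List (Fin (N * N))
  image v (u , w) = cell (side v u) (side v w)

  copy : Vec (Fin (N + N)) p → List (Fin (N * N))
  copy v = concatMap (image v) edges

  module _ (v : Vec (Fin (N + N)) p) (inj : Injective _≡_ _≡_ (lookup v)) where

    images-disjoint : ∀ {es} → Unique es → All (λ (u , w) → u Fin.< w) es →
      AllPairs (λ e e′ → Disjoint (image v e) (image v e′)) es
    images-disjoint [] [] = []
    images-disjoint {e ∷ es} (e∉es ∷ uniq) (e< ∷ es<) =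
      All.zipWith (λ (ne , e′<) {_} → disjoint ne e< e′<) (e∉es , es<) ∷ images-disjoint uniq es<
      where
      disjoint : ∀ {e e′} → e ≢ e′ → proj₁ e Fin.< proj₂ e → proj₁ e′ Fin.< proj₂ e′ →
        Disjoint (image v e) (image v e′)
      disjoint {u , w} {u′ , w′} ne u<w u′<w′ (t∈ , t∈′)
        with cell-injective (side v u) (side v w) (side v u′) (side v w′) t∈ t∈′
      ... | inj₁ (eq , eq′) = ne (cong₂ _,_ (inj (splitAt-injective eq)) (inj (splitAt-injective eq′)))
      -- Exchanged ends would reverse the order, but both edges are listed with increasing ends.
      ... | inj₂ (eq , eq′) = <-asym u<w (subst₂ Fin._<_
              (sym (inj (splitAt-injective eq′))) (sym (inj (splitAt-injective eq))) u′<w′)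

    copy-unique : Unique (copy v)
    copy-unique = Unique.concat⁺
      (All.map⁺ (All.universal (λ (u , w) → unique-cell (side v u) (side v w)) edges))
      (AllPairs.map⁺ (images-disjoint edges-unique (All.map proj₁ edges-adj)))

  length-copy : ∀ {R} v → (∀ u w → Adj u w → Across {N} {N} R (side v u) (side v w)) →
    length (copy v) ≡ length edges
  length-copy v hom = go edges
    (All.map (λ {(u , w)} (_ , a) → length-cell (side v u) (side v w) (hom u w a)) edges-adj)
    where
    go : ∀ es → All (λ e → length (image v e) ≡ 1) es → length (concatMap (image v) es) ≡ length es
    go []       []         = refl
    go (e ∷ es) (eq ∷ eqs) = trans (length-++ (image v e)) (cong₂ _+_ eq (go es eqs))

  copy-red : ∀ {c} v →
    (∀ u w → Adj u w → Across (λ i j → colouring c i j ≡ red) (side v u) (side v w)) →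
    IsMono red (copy v) c
  copy-red {c} v hom = All.concat⁺ (All.map⁺
    (All.map (λ {(u , w)} (_ , a) → cell-red {c} (side v u) (side v w) (hom u w a)) edges-adj))

  -- Ranges over all vertex maps, not only embeddings. The test keeps every embedding; other
  -- survivors are harmless, as only their size, their uniqueness and an upper bound on their number
  -- matter.
  copies : List (List (Fin (N * N)))
  copies = filter (simple? ∣E G ∣) (map copy (words (N + N) p))

  copies-simple : All (Simple ∣E G ∣) copies
  copies-simple = All.all-filter (simple? ∣E G ∣) (map copy (words (N + N) p))

  red-copy : ∀ {c : Vec Colour (N * N)} → G ⊑ colourClass (colouring c) red →
    ∃ λ g → g ∈ copies × IsMono red g c
  red-copy {c} (f , inj , hom) =
    copy v , ∈-filter⁺ (simple? ∣E G ∣) (∈-map⁺ copy (∈-words v)) (copy-unique v inj′ , length-copy v hom′) ,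
    copy-red {c} v hom′
    where
    v = tabulate f
    inj′ : Injective _≡_ _≡_ (lookup v)
    inj′ {x} {y} eq = inj (trans (sym (lookup∘tabulate f x)) (trans eq (lookup∘tabulate f y)))
    hom′ : ∀ u w → Adj u w →
      Across (λ i j → colouring c i j ≡ red) (side v u) (side v w)
    hom′ u w a = subst₂ (λ x y → Across (λ i j → colouring c i j ≡ red) (splitAt N x) (splitAt N y))
      (sym (lookup∘tabulate f u)) (sym (lookup∘tabulate f w)) (hom u w a)

-- Some edge of G must go to some position of `T` in one of two orientations. This fixes two
-- vertices, and each of the other `m` has 2N places.
count-meeting-copies : ∀ {m} N (G : Graph (2 + m)) (T : List (Fin (N * N))) → let open Copies G N in
  length (filter (meets? T) copies) ≤ ∣E G ∣ * (length T + length T) * (N + N) ℕ.^ m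
count-meeting-copies {m} N G T = begin
  length (filter (meets? T) copies)                   ≤⟨ length-filter-filter (meets? T) (simple? ∣E G ∣) (map copy ws) ⟩
  length (filter (meets? T) (map copy ws))                ≡⟨ length-filter-map (meets? T) copy ws ⟩
  length (filter (meets? T ∘ copy) ws)                    ≤⟨ length-filter-Any (meets? T ∘ copy) pinned? ws (λ {v} → pin {v})
                                                               (All.tabulate few) ⟩
  length (cartesianProduct edges (orientedEnds T)) * (N + N) ℕ.^ m
    ≡⟨ cong (_* (N + N) ℕ.^ m) (trans (length-cartesianProductWith _,_ edges (orientedEnds T))
         (cong (length edges *_) (length-orientedEnds T))) ⟩
  ∣E G ∣ * (length T + length T) * (N + N) ℕ.^ m            ∎
  where
  open ≤-Reasoning
  open Copies G N
  open Cells N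
  ws = words (N + N) (2 + m)

  Pinned : (Fin (2 + m) × Fin (2 + m)) × (Fin (N + N) × Fin (N + N)) → Pred (Vec (Fin (N + N)) (2 + m)) 0ℓ
  Pinned ((u , w) , (x , y)) v = lookup v u ≡ x × lookup v w ≡ y

  pinned? : ∀ i → Decidable (Pinned i)
  pinned? ((u , w) , (x , y)) v = (lookup v u Fin.≟ x) ×-dec (lookup v w Fin.≟ y)

  pin : ∀ {v} → Meets T (copy v) → Any (λ i → Pinned i v) (cartesianProduct edges (orientedEnds T))
  pin {v} meets =
    let t , t∈copy , t∈T = find meets
        (u , w) , e∈ , t∈cell = find (∈-concatMap⁻ (image v) {xs = edges} t∈copy)
    in lose (∈-cartesianProduct⁺ e∈ (∈-cell⇒∈-orientedEnds (lookup v u) (lookup v w) t∈cell t∈T)) (refl , refl)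

  few : ∀ {i} → i ∈ cartesianProduct edges (orientedEnds T) →
    length (filter (pinned? i) ws) ≤ (N + N) ℕ.^ m
  few {i@((u , w) , _)} i∈ = length-filter-lookup₂ (pinned? i)
    (Fin.<⇒≢ (proj₁ (All.lookup edges-adj (proj₁ (∈-cartesianProduct⁻ edges (orientedEnds T) i∈))))) id

module Rectangles (N : ℕ) where

  open Cells N

  rectangle : ∀ {n} → Vec (Fin N) n → Vec (Fin N) n → List (Fin (N * N))
  rectangle {n} X Y = cartesianProductWith (λ i j → combine (lookup X i) (lookup Y j)) (allFin n) (allFin n)

  rectangles : ℕ → List (List (Fin (N * N)))
  rectangles n = filter (simple? (n * n)) (cartesianProductWith rectangle (words N n) (words N n))

  length-rectangles : ∀ n → length (rectangles n) ≤ (N * N) ℕ.^ n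
  length-rectangles n = begin
    length (rectangles n)
      ≤⟨ length-filter (simple? (n * n)) (cartesianProductWith rectangle (words N n) (words N n)) ⟩
    length (cartesianProductWith rectangle (words N n) (words N n))
      ≡⟨ length-cartesianProductWith rectangle (words N n) (words N n) ⟩
    length (words N n) * length (words N n)                  ≡⟨ cong₂ _*_ (length-words n) (length-words n) ⟩
    N ℕ.^ n * N ℕ.^ n                                            ≡⟨ *-distrib-^ N N n ⟨
    (N * N) ℕ.^ n                                              ∎
    where open ≤-Reasoning

  BlueRectangle : ℕ → Colouring N → Set
  BlueRectangle n c = ∃ λ (X : Vec (Fin N) n) → ∃ λ (Y : Vec (Fin N) n) →
    Injective _≡_ _≡_ (lookup X) × Injective _≡_ _≡_ (lookup Y) × (∀ i j → c (lookup X i) (lookup Y j) ≡ blue)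

  blue-rectangle : ∀ {n c} → BlueRectangle n (colouring c) → ∃ λ T → T ∈ rectangles n × IsMono blue T c
  blue-rectangle {n} {c} (X , Y , X-inj , Y-inj , all-blue) =
    rectangle X Y ,
    ∈-filter⁺ (simple? (n * n)) (∈-cartesianProductWith⁺ rectangle (∈-words X) (∈-words Y))
      ( Unique.cartesianProductWith⁺ _
          (λ eq → let eqX , eqY = Fin.combine-injective _ _ _ _ eq in X-inj eqX , Y-inj eqY)
          (Unique.allFin⁺ n) (Unique.allFin⁺ n)
      , trans (length-cartesianProductWith _ (allFin n) (allFin n))
          (cong₂ _*_ (length-tabulate {n = n} id) (length-tabulate {n = n} id)) ) ,
    All.tabulate λ t∈ → case t∈
    where
    case : ∀ {t} → t ∈ rectangle X Y → lookup c t ≡ blue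
    case t∈ with i , j , _ , _ , refl ← ∈-cartesianProductWith⁻ _ (allFin n) (allFin n) t∈ = all-blue i j

  -- The side of the first vertex L zero decides the side of every other vertex.
  complete⇒BlueRectangle : ∀ {n c} (L R : Fin (suc n) → Fin N ⊎ Fin N) → Injective _≡_ _≡_ L → Injective _≡_ _≡_ R →
    (∀ i j → Across (λ i j → c i j ≡ blue) (L i) (R j)) → BlueRectangle (suc n) c
  complete⇒BlueRectangle {n} {c} L R L-inj R-inj adj with L zero in L₀
  ... | inj₁ a = X , Y , X-inj , Y-inj , λ i j → subst₂ (Across _) (X-eq i) (Y-eq j) (adj i j)
    where
    right : ∀ j → ∃ λ y → R j ≡ inj₂ y
    right j with R j | subst (λ x → Across (λ i j → c i j ≡ blue) x (R j)) L₀ (adj zero j)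
    ... | inj₂ y | _ = y , refl
    left : ∀ i → ∃ λ x → L i ≡ inj₁ x
    left i with L i | subst (Across (λ i j → c i j ≡ blue) (L i)) (proj₂ (right zero)) (adj i zero)
    ... | inj₁ x | _ = x , refl
    X = tabulate (proj₁ ∘ left)
    Y = tabulate (proj₁ ∘ right)
    X-eq : ∀ i → L i ≡ inj₁ (lookup X i)
    X-eq i = trans (proj₂ (left i)) (cong inj₁ (sym (lookup∘tabulate (proj₁ ∘ left) i)))
    Y-eq : ∀ j → R j ≡ inj₂ (lookup Y j)
    Y-eq j = trans (proj₂ (right j)) (cong inj₂ (sym (lookup∘tabulate (proj₁ ∘ right) j)))
    X-inj : Injective _≡_ _≡_ (lookup X)
    X-inj eq = L-inj (trans (X-eq _) (trans (cong inj₁ eq) (sym (X-eq _))))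
    Y-inj : Injective _≡_ _≡_ (lookup Y)
    Y-inj eq = R-inj (trans (Y-eq _) (trans (cong inj₂ eq) (sym (Y-eq _))))
  ... | inj₂ a = X , Y , X-inj , Y-inj , λ i j → subst₂ (Across _) (Y-eq j) (X-eq i) (adj j i)
    where
    right : ∀ j → ∃ λ x → R j ≡ inj₁ x
    right j with R j | subst (λ x → Across (λ i j → c i j ≡ blue) x (R j)) L₀ (adj zero j)
    ... | inj₁ x | _ = x , refl
    left : ∀ i → ∃ λ y → L i ≡ inj₂ y
    left i with L i | subst (Across (λ i j → c i j ≡ blue) (L i)) (proj₂ (right zero)) (adj i zero)
    ... | inj₂ y | _ = y , refl
    X = tabulate (proj₁ ∘ right)
    Y = tabulate (proj₁ ∘ left)
    X-eq : ∀ i → R i ≡ inj₁ (lookup X i)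
    X-eq i = trans (proj₂ (right i)) (cong inj₁ (sym (lookup∘tabulate (proj₁ ∘ right) i)))
    Y-eq : ∀ j → L j ≡ inj₂ (lookup Y j)
    Y-eq j = trans (proj₂ (left j)) (cong inj₂ (sym (lookup∘tabulate (proj₁ ∘ left) j)))
    X-inj : Injective _≡_ _≡_ (lookup X)
    X-inj eq = R-inj (trans (X-eq _) (trans (cong inj₁ eq) (sym (X-eq _))))
    Y-inj : Injective _≡_ _≡_ (lookup Y)
    Y-inj eq = L-inj (trans (Y-eq _) (trans (cong inj₂ eq) (sym (Y-eq _))))

  K⇒BlueRectangle : ∀ {n c} → K (suc n) (suc n) ⊑ colourClass c blue → BlueRectangle (suc n) c
  K⇒BlueRectangle {n} {c} (h , inj , hom) = complete⇒BlueRectangle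
    (λ i → splitAt N (h (i ↑ˡ suc n))) (λ j → splitAt N (h (suc n ↑ʳ j)))
    (λ eq → Fin.↑ˡ-injective (suc n) _ _ (inj (splitAt-injective eq)))
    (λ eq → Fin.↑ʳ-injective (suc n) _ _ (inj (splitAt-injective eq)))
    (λ i j → hom _ _ (subst₂ (Across (λ _ _ → ⊤))
      (sym (Fin.splitAt-↑ˡ (suc n) i (suc n))) (sym (Fin.splitAt-↑ʳ (suc n) (suc n) j)) tt))

-- The union bound over rectangles

sum≡0⇒≡0 : ∀ {A : Set} (f : A → ℕ) {xs x} → x ∈ xs → sum (map f xs) ≡ 0 → f x ≡ 0
sum≡0⇒≡0 f {x ∷ xs} (here refl) eq = m+n≡0⇒m≡0 (f x) eq
sum≡0⇒≡0 f {y ∷ xs} (there x∈)  eq = sum≡0⇒≡0 f x∈ (m+n≡0⇒n≡0 (f y) eq)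

-- The counterexample is `clean L c` for a `c` at which `bad` vanishes. The constant 4 is twice the
-- factor 2 from the orientations: the copies may use only half of the exponent n².
not-arrows : ∀ {m N n b Δ} (G : Graph (2 + m)) → 0 ℕ.< ∣E G ∣ → 0 ℕ.< n → 0 ℕ.< b →
  4 * ∣E G ∣ * (N + N) ℕ.^ m * suc b ≤ b ℕ.^ ∣E G ∣ → N * N ℕ.< Δ → Δ * Δ * b ℕ.^ n ≤ suc b ℕ.^ n →
  ¬ Arrows G (K n n) N
not-arrows {m} {N} {n@(suc _)} {b} {Δ} G q>0 n>0 b>0 small N²<Δ Δ≤ arrows =
  [ no-red , no-blue ]′ (arrows (colouring (clean L c)))
  where
  open Weighted b
  open Cells N
  open Copies G N
  open Rectangles N
  q = ∣E G ∣
  L = copies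
  W = suc b ℕ.^ (N * N)

  meeting : List (Fin (N * N)) → List (List (Fin (N * N)))
  meeting T = filter (meets? T) L

  bad : Vec Colour (N * N) → ℕ
  bad c = sum (map (λ T → φ T (meeting T) c) (rectangles n))

  bound : ∀ {T} → Simple (n * n) T → Δ ℕ.^ n * 𝔼 (φ T (meeting T)) ≤ W
  bound {T} (uniq , len) = rectangle-bound {x = b ℕ.^ q} {b} {n} {4 * q * (N + N) ℕ.^ m} {length (meeting T)} {Δ}
    {{m^n≢0 b q {{>-nonZero b>0}}}}
    (𝔼-φ T (meeting T) (All.filter⁺ (meets? T) copies-simple))
    (subst (λ z → suc b ℕ.^ z * 𝔼 (mono blue T) ≡ b ℕ.^ z * W) len (𝔼-blue uniq))
    (begin
      length (meeting T) + length (meeting T)            ≤⟨ +-mono-≤ few few ⟩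
      q * (n * n + n * n) * M + q * (n * n + n * n) * M  ≡⟨ regroup q (n * n) M ⟩
      4 * q * M * (n * n)                                ∎)
    small Δ≤
    where
    open ≤-Reasoning
    M = (N + N) ℕ.^ m
    few : length (meeting T) ≤ q * (n * n + n * n) * M
    few = subst (λ z → length (meeting T) ≤ q * (z + z) * M) len (count-meeting-copies N G T)
    regroup : ∀ q s M → q * (s + s) * M + q * (s + s) * M ≡ 4 * q * M * s
    regroup = solve-∀

  𝔼-bad : 𝔼 bad ℕ.< 𝔼 {N * N} (λ _ → 1)
  -- Each rectangle has mass at most W/Δ^n, and there are fewer than Δ^n of them.
  𝔼-bad = *-cancelˡ-< (Δ ℕ.^ n) _ _ (begin-strict
    Δ ℕ.^ n * 𝔼 bad              ≤⟨ 𝔼-sum {D = Δ ℕ.^ n} (λ T → φ T (meeting T)) (rectangles n)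
                                    (All.map bound (All.all-filter (simple? (n * n)) (cartesianProductWith rectangle (words N n) (words N n)))) ⟩
    length (rectangles n) * W  ≤⟨ *-monoˡ-≤ W (length-rectangles n) ⟩
    (N * N) ℕ.^ n * W            <⟨ *-monoˡ-< W {{m^n≢0 (suc b) (N * N)}} (^-monoˡ-< n N²<Δ) ⟩
    Δ ℕ.^ n * W                  ≡⟨ cong (Δ ℕ.^ n *_) (𝔼-1 (N * N)) ⟨
    Δ ℕ.^ n * 𝔼 {N * N} (λ _ → 1) ∎)
    where open ≤-Reasoning

  c : Vec Colour (N * N)
  c = proj₁ (𝔼-pos bad 𝔼-bad)

  no-red : ¬ G ⊑ colourClass (colouring (clean L c)) red
  no-red G⊑ = let g , g∈L , g-red = red-copy {clean L c} G⊑ in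
    clean-not-red c g∈L
      (subst (0 ℕ.<_) (sym (proj₂ (All.lookup copies-simple g∈L))) q>0) g-red

  no-blue : ¬ K n n ⊑ colourClass (colouring (clean L c)) blue
  no-blue K⊑ = let T , T∈ , T-blue = blue-rectangle {c = clean L c} (K⇒BlueRectangle K⊑) in
    contradiction (clean-blue⇒φ T L ≽-refl (All.tabulate λ _ → refl) T-blue)
      (<⇒≱ (s≤s (≤-reflexive (sum≡0⇒≡0 (λ T → φ T (meeting T) c) T∈ (proj₂ (𝔼-pos bad 𝔼-bad))))))

-- Bounds on cuts

-- frac a d is a / (1 + d).
frac : ℕ → ℕ → ℚᵘ
frac a d = mkℚᵘ (ℤ.+ a) d

frac-< : ∀ {a b c d} → a * suc d ℕ.< c * suc b → frac a b ℚ.< frac c d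
frac-< {a} {b} {c} {d} lt = *<* (subst₂ ℤ._<_ (ℤ.pos-* a (suc d)) (ℤ.pos-* c (suc b)) (ℤ.+<+ lt))

frac-≤ : ∀ {a b c d} → a * suc d ≤ c * suc b → frac a b ℚ.≤ frac c d
frac-≤ {a} {b} {c} {d} le = *≤* (subst₂ ℤ._≤_ (ℤ.pos-* a (suc d)) (ℤ.pos-* c (suc b)) (ℤ.+≤+ le))

frac-* : ∀ a b c d → frac a b ℚ.* frac c d ≡ frac (a * c) (d + b * suc d)
frac-* a b c d = cong (λ z → mkℚᵘ z (d + b * suc d)) (sym (ℤ.pos-* a c))

frac-*-≤ : ∀ {a b c d x y} → a * c * suc y ≤ x * (suc b * suc d) → frac a b ℚ.* frac c d ℚ.≤ frac x y
frac-*-≤ {a} {b} {c} {d} {x} {y} le = subst (ℚ._≤ frac x y) (sym (frac-* a b c d)) (frac-≤ le)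

frac-*-≥ : ∀ {a b c d x y} → x * (suc b * suc d) ≤ a * c * suc y → frac x y ℚ.≤ frac a b ℚ.* frac c d
frac-*-≥ {a} {b} {c} {d} {x} {y} le = subst (frac x y ℚ.≤_) (sym (frac-* a b c d)) (frac-≤ le)

ι : ℕ → ℚᵘ
ι n = frac n 0

ι-* : ∀ a b → ι a ℚ.* ι b ≡ ι (a * b)
ι-* a b = frac-* a 0 b 0

ι-^ : ∀ a k → ι a ^ℚ k ≡ ι (a ℕ.^ k)
ι-^ a zero    = refl
ι-^ a (suc k) = trans (cong (ι a ℚ.*_) (ι-^ a k)) (ι-* a (a ℕ.^ k))

ι-< : ∀ {a b} → a ℕ.< b → ι a ℚ.< ι b
ι-< {a} {b} lt = frac-< (subst₂ ℕ._<_ (sym (*-identityʳ a)) (sym (*-identityʳ b)) lt)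

ι-*-≤ : ∀ {a b c} → a * b ≤ c → ι a ℚ.* ι b ℚ.≤ ι c
ι-*-≤ {a} {b} {c} le = frac-*-≤ {a} {0} {b} {0} {c} {0} (*-monoˡ-≤ 1 le)

ι-*-≥ : ∀ {a b c} → c ≤ a * b → ι c ℚ.≤ ι a ℚ.* ι b
ι-*-≥ {a} {b} {c} le = frac-*-≥ {a} {0} {b} {0} {c} {0} (*-monoˡ-≤ 1 le)

-- The factor 2 makes the bound strict for j = 0.
Upper-^ℕ : ∀ Y {y} → Upper Y (ι y) → ∀ j {u} → 2 * y ℕ.^ j ≤ u → Upper (Y ^ℕ j) (ι u)
Upper-^ℕ Y     Uy zero    le = ι-< le
Upper-^ℕ Y {y} Uy (suc j) le = ι y , ι (2 * y ℕ.^ j) , Uy , Upper-^ℕ Y Uy j ≤-refl ,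
  ι-*-≤ {y} (≤-trans (≤-reflexive (commute y (y ℕ.^ j))) le)
  where
  commute : ∀ y z → y * (2 * z) ≡ 2 * (y * z)
  commute = solve-∀

Upper-root : ∀ k {X t} → 0 ℕ.< t → Upper X (ι (t ℕ.^ suc k)) → Upper (root (suc k) X) (ι t)
Upper-root k {X} {t} 0<t U = ι-< 0<t , subst (Upper X) (sym (ι-^ t (suc k))) U

Lower-root : ∀ k {X t} → 0 ℕ.< t → Lower X (ι (t ℕ.^ suc k)) → Lower (root (suc k) X) (ι t)
Lower-root k {X} {t} 0<t U = ι-< 0<t , subst (Lower X) (sym (ι-^ t (suc k))) U

-- The bounds on e come from (3/2)^2 and (3/2)^3.
e<7/2 : Upper e (frac 7 1)
e<7/2 = 1 , frac-< {27} {7} {7} {1} (m≤m+n 55 1)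

e<4 : Upper e (ι 4)
e<4 = 1 , frac-< {27} {7} {4} {0} (m≤m+n 28 4)

e^<4^ : ∀ j {u} → 4 ℕ.^ suc j ≤ u → Upper (e ^ℕ suc j) (ι u)
-- Upper bounds of the zeroth power lie strictly above 1, so the first power needs slack: 7/2 · 8/7
-- = 4.
e^<4^ zero    {u} le = frac 7 1 , frac 8 6 , e<7/2 , frac-< {1} {0} {8} {6} (m≤m+n 8 0) ,
  frac-*-≤ {7} {1} {8} {6} {u} {0} (≤-trans (m≤m+n 56 0) (*-monoˡ-≤ 14 le))
e^<4^ (suc j) le = ι 4 , ι (4 ℕ.^ suc j) , e<4 , e^<4^ j ≤-refl , ι-*-≤ {4} {4 ℕ.^ suc j} le

17/8<e : Lower e (frac 17 7)
17/8<e = frac-< {0} {0} {17} {7} (s≤s z≤n) , 1 , frac-< {17} {7} {9} {3} (m≤m+n 69 3)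

2<e : Lower e (ι 2)
2<e = ι-< (s≤s z≤n) , 1 , frac-< {2} {0} {9} {3} (m≤m+n 9 0)

2^<e^ : ∀ j {u} → 0 ℕ.< u → u ≤ 2 ℕ.^ suc j → Lower (e ^ℕ suc j) (ι u)
-- Likewise from below: 17/8 · 16/17 = 2.
2^<e^ zero    {u} 0<u le = ι-< 0<u , frac 17 7 , frac 16 16 , 17/8<e ,
  (frac-< {0} {0} {16} {16} (s≤s z≤n) , frac-< {16} {16} {1} {0} (m≤m+n 17 0)) ,
  frac-*-≥ {17} {7} {16} {16} {u} {0} (≤-trans (*-monoˡ-≤ 136 le) (m≤m+n 272 0))
2^<e^ (suc j) 0<u le = ι-< 0<u , ι 2 , ι (2 ℕ.^ suc j) , 2<e ,
  2^<e^ j (m^n>0 2 (suc j)) ≤-refl , ι-*-≥ {2} {2 ℕ.^ suc j} le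

ℓ<log : ∀ {ℓ n} → 0 ℕ.< ℓ → 4 ℕ.^ ℓ ℕ.< n → Lower (log n) (ι ℓ)
ℓ<log {suc j} {n} 0<ℓ lt = ι-< 0<ℓ , ι (4 ℕ.^ suc j) ,
  Upper-root 0 {e ^ℕ suc j} pos (e^<4^ j (≤-reflexive (sym (*-identityʳ _)))) ,
  ι-< pos , ι-< lt
  where
  pos : 0 ℕ.< 4 ℕ.^ suc j
  pos = m^n>0 4 (suc j)

-- Separated by `2 + n`: n + 1 < n + 2 ≤ 2^(n + 1) < e^(n + 1).
log<n : ∀ n → Upper (log (suc n)) (ι (suc n))
log<n n = ι-< (s≤s z≤n) , ι (2 + n) , ι-< ≤-refl ,
  Lower-root 0 {e ^ℕ suc n} (s≤s z≤n) (2^<e^ n (s≤s z≤n)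
    (≤-trans (≤-reflexive (*-identityʳ (2 + n))) (n<2^n (suc n))))

-- The bound is (n + 1) · (1/ℓ); the numerator is n + 1 because upper bounds of n are strict.
n/log-upper : ∀ {ℓ n y} → 0 ℕ.< ℓ → 4 ℕ.^ ℓ ℕ.< n → suc n ≤ y * ℓ → Upper (fromℕ n ÷ᶜ log n) (ι y)
n/log-upper {ℓ@(suc j)} {n} {y} 0<ℓ lt le = ι (suc n) , frac 1 j , ι-< ≤-refl ,
  (ι ℓ , ℓ<log 0<ℓ lt , frac-*-≥ {1} {j} {ℓ} {0} {1} {0} (≤-reflexive (unit ℓ))) ,
  frac-*-≤ {suc n} {0} {1} {j} {y} {0} (≤-trans (≤-reflexive (unit′ (suc n)))
    (≤-trans le (≤-reflexive (unit″ y ℓ))))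
  where
  unit : ∀ ℓ → 1 * (ℓ * 1) ≡ 1 * ℓ * 1
  unit = solve-∀
  unit′ : ∀ n → n * 1 * 1 ≡ n
  unit′ = solve-∀
  unit″ : ∀ y ℓ → y * ℓ ≡ y * (1 * ℓ)
  unit″ = solve-∀

n/log-lower : ∀ n → Lower (fromℕ (2 + n) ÷ᶜ log (2 + n)) (frac 1 1)
n/log-lower n = frac-< {0} {0} {1} {1} (s≤s z≤n) , ι (suc n) , frac 1 (suc n) ,
  (ι-< (s≤s z≤n) , ι-< ≤-refl) ,
  (frac-< {0} {0} {1} {suc n} (s≤s z≤n) , ι (2 + n) , log<n (suc n) ,
    frac-*-≤ {1} {suc n} {2 + n} {0} {1} {0} (≤-reflexive (unit (2 + n)))) ,
  frac-*-≥ {suc n} {0} {1} {suc n} {1} {1}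
    (≤-trans (m≤m+n _ n) (≤-reflexive (half n)))
  where
  unit : ∀ x → 1 * x * 1 ≡ 1 * (x * 1)
  unit = solve-∀
  half : ∀ n → 1 * (1 * (2 + n)) + n ≡ (1 + n) * 1 * 2
  half = solve-∀

-- The constant 1/(2a + 3) is strictly below 1/(2a + 2), and the latter times (a + 1) N is N/2, the
-- rational that separates the two cuts.
scale-<ᶜ : ∀ a {X N} → 0 ℕ.< N → Upper X (ι (suc a * N)) → fromℚ (frac 1 (2 + (a + a))) *ᶜ X <ᶜ fromℕ N
scale-<ᶜ a {X} {N} 0<N U = frac N 1 ,
  (frac 1 (suc (a + a)) , ι (suc a * N) ,
    frac-< {1} {2 + (a + a)} {1} {suc (a + a)} (≤-reflexive (step a)) , U ,
    frac-*-≤ {1} {suc (a + a)} {suc a * N} {0} {N} {1} (≤-reflexive (half a N))) ,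
  frac-< {0} {0} {N} {1} (≤-trans 0<N (≤-reflexive (sym (*-identityʳ N)))) ,
  frac-< {N} {1} {N} {0} (*-monoʳ-< N {{>-nonZero 0<N}} (s≤s (s≤s z≤n)))
  where
  step : ∀ a → suc (1 * (2 + (a + a))) ≡ 1 * (3 + (a + a))
  step = solve-∀
  half : ∀ a N → 1 * ((1 + a) * N) * 2 ≡ N * ((2 + (a + a)) * 1)
  half = solve-∀

-- From the finite inequality to the lower bound

arrows⇒>0 : ∀ {p n N} (G : Graph (suc p)) → 0 ℕ.< n → Arrows G (K n n) N → 0 ℕ.< N
arrows⇒>0 {N = suc N} G _ _ = s≤s z≤n
arrows⇒>0 {n = suc n} {zero} G _ arrows with arrows (λ ())
... | inj₁ (f , _) with () ← f zero
... | inj₂ (f , _) with () ← f zero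

x≤x^1+k : ∀ x k → x ≤ x ℕ.^ suc k
x≤x^1+k zero      k = z≤n
x≤x^1+k x@(suc _) k = ≤-trans (≤-reflexive (sym (*-identityʳ x))) (*-monoʳ-≤ x (m^n>0 x k))

-- Contrapositive of `not-arrows`. The failing inequality itself bounds `N` by `b ^ q`, since p - 2
-- ≥ 1, and this is what `Δ>` asks for.
arrows⇒large : ∀ {m n N q} (G : Graph (3 + m)) → ∣E G ∣ ≡ suc q → (par : Parameters q n) → 0 ℕ.< n →
  Arrows G (K n n) N → let open Parameters par in
  b ℕ.^ suc q ℕ.< 4 * suc q * (N + N) ℕ.^ suc m * suc b
arrows⇒large {m} {n} {N} {q} G eq par 0<n arrows with 4 * suc q * (N + N) ℕ.^ suc m * suc b ≤? b ℕ.^ suc q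
  where open Parameters par
... | no  large = ≰⇒> large
... | yes small = contradiction arrows (not-arrows G (subst (0 ℕ.<_) (sym eq) (s≤s z≤n)) 0<n b>0
  (subst (λ q → 4 * q * (N + N) ℕ.^ suc m * suc b ≤ b ℕ.^ q) (sym eq) small)
  (Δ> N N≤b^q) Δ≤)
  where
  open Parameters par
  open ≤-Reasoning
  N≤b^q : N ≤ b ℕ.^ q
  N≤b^q = *-cancelʳ-≤ N _ (suc b) (begin
    N * suc b                                  ≤⟨ *-monoˡ-≤ (suc b) (m≤m+n N N) ⟩
    (N + N) * suc b                            ≤⟨ *-monoˡ-≤ (suc b) (x≤x^1+k (N + N) m) ⟩
    (N + N) ℕ.^ suc m * suc b                  ≤⟨ *-monoˡ-≤ (suc b) (m≤n*m ((N + N) ℕ.^ suc m) (4 * suc q)) ⟩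
    4 * suc q * (N + N) ℕ.^ suc m * suc b      ≤⟨ small ⟩
    b * b ℕ.^ q                                ≤⟨ *-monoˡ-≤ (b ℕ.^ q) (n≤1+n b) ⟩
    suc b * b ℕ.^ q                            ≡⟨ *-comm (suc b) (b ℕ.^ q) ⟩
    b ℕ.^ q * suc b                            ∎)

-- The product of 2, demanded by `Upper-^ℕ`, of (32 (q + 1))^q from the bound on n / log n, and of 8
-- (q + 1) 2^(m + 1) from b^q ≤ 8 (q + 1) (2N)^(m + 1).
factor : ℕ → ℕ → ℕ
factor q m = 16 * suc q * 2 ℕ.^ suc m * (32 * suc q) ℕ.^ q

large⇒power-≤ : ∀ {b N q m} → 0 ℕ.< b → b ℕ.^ suc q ℕ.< 4 * suc q * (N + N) ℕ.^ suc m * suc b →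
  2 * (32 * suc q * b) ℕ.^ q ≤ (factor q m * N) ℕ.^ suc m
large⇒power-≤ {b} {N} {q} {m} 0<b large = begin
  2 * (a * b) ℕ.^ q                        ≡⟨ cong (2 *_) (*-distrib-^ a b q) ⟩
  2 * (a ℕ.^ q * b ℕ.^ q)                  ≤⟨ *-monoʳ-≤ 2 (*-monoʳ-≤ (a ℕ.^ q) b^q≤) ⟩
  2 * (a ℕ.^ q * (8 * suc q * (t * s)))    ≡⟨ regroup₁ (suc q) (a ℕ.^ q) t s ⟩
  -- Raising the constant to the power m + 1 lets the later root be taken exactly.
  factor q m * s                           ≤⟨ *-monoˡ-≤ s (x≤x^1+k (factor q m) m) ⟩
  factor q m ℕ.^ suc m * s                 ≡⟨ *-distrib-^ (factor q m) N (suc m) ⟨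
  (factor q m * N) ℕ.^ suc m               ∎
  where
  open ≤-Reasoning
  a = 32 * suc q
  s = N ℕ.^ suc m
  t = 2 ℕ.^ suc m
  regroup₁ : ∀ q x t s → 2 * (x * (8 * q * (t * s))) ≡ 16 * q * t * x * s
  regroup₁ = solve-∀
  regroup₂ : ∀ q x b → 4 * q * x * (b + b) ≡ b * (8 * q * x)
  regroup₂ = solve-∀
  double : ∀ N → N + N ≡ 2 * N
  double = solve-∀
  b^q≤ : b ℕ.^ q ≤ 8 * suc q * (t * s)
  b^q≤ = *-cancelˡ-≤ b {{>-nonZero 0<b}} (begin
    b * b ℕ.^ q                            ≤⟨ <⇒≤ large ⟩
    4 * suc q * (N + N) ℕ.^ suc m * suc b  ≤⟨ *-monoʳ-≤ (4 * suc q * (N + N) ℕ.^ suc m) (+-monoˡ-≤ b 0<b) ⟩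
    4 * suc q * (N + N) ℕ.^ suc m * (b + b) ≡⟨ regroup₂ (suc q) ((N + N) ℕ.^ suc m) b ⟩
    b * (8 * suc q * (N + N) ℕ.^ suc m)    ≡⟨ cong (λ z → b * (8 * suc q * z))
                                                (trans (cong (ℕ._^ suc m) (double N)) (*-distrib-^ 2 N (suc m))) ⟩
    b * (8 * suc q * (t * s))              ∎)

LowerBound : ∀ {p} → Graph p → ℚᵘ → Set
LowerBound G x = ∃ λ C → 0ℚᵘ < C × ∃ λ n₀ → ∀ n → n ≥ n₀ → ∀ {N} → Arrows G (K n n) N →
  fromℚ C *ᶜ (fromℕ n ÷ᶜ log n) ^ x <ᶜ fromℕ N

-- The exponent is negative, so n / log n > 1/2 and N ≥ 1 suffice. The lower bound drops to 1/4 =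
-- 1/2 · 1/2 because lower bounds of the zeroth power lie strictly below 1; the resulting 4N gives C
-- = 1/9.
edgeless : ∀ {m} (G : Graph (3 + m)) → LowerBound G (mkℚᵘ ℤ.-[1+ 0 ] m)
edgeless {m} G = frac 1 8 , frac-< {0} {0} {1} {8} (s≤s z≤n) , 2 , bound
  where
  bound : ∀ n → n ≥ 2 → ∀ {N} → Arrows G (K n n) N →
    fromℚ (frac 1 8) *ᶜ (fromℕ n ÷ᶜ log n) ^ mkℚᵘ ℤ.-[1+ 0 ] m <ᶜ fromℕ N
  bound (suc zero) (s≤s ())
  bound n@(suc (suc n′)) _ {N} arrows = scale-<ᶜ 3 {X} 0<N
    (Upper-root m {Y⁻¹} (≤-trans 0<N (m≤n*m N 4))
      (frac 1 3 ,
        (frac-< {0} {0} {1} {3} (s≤s z≤n) , frac 1 1 , frac 1 1 , n/log-lower n′ ,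
          (frac-< {0} {0} {1} {1} (s≤s z≤n) , frac-< {1} {1} {1} {0} (s≤s (s≤s z≤n))) ,
          frac-*-≥ {1} {1} {1} {1} {1} {3} ≤-refl) ,
        frac-*-≥ {(4 * N) ℕ.^ suc m} {0} {1} {3} {1} {0} quarter))
    where
    Y⁻¹ = (fromℕ n ÷ᶜ log n) ^ℤ ℤ.-[1+ 0 ]
    X = root (suc m) Y⁻¹
    0<N : 0 ℕ.< N
    0<N = arrows⇒>0 G (s≤s z≤n) arrows
    quarter : 4 ≤ (4 * N) ℕ.^ suc m * 1 * 1
    quarter = ≤-trans (≤-trans (*-monoʳ-≤ 4 0<N) (x≤x^1+k (4 * N) m))
      (≤-reflexive (sym (trans (*-identityʳ _) (*-identityʳ _))))

nonempty : ∀ {m q} (G : Graph (3 + m)) → ∣E G ∣ ≡ suc q → LowerBound G (mkℚᵘ (ℤ.+ q) m)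
nonempty {m} {q} G eq = C , frac-< {0} {0} {1} {2 + (a + a)} (s≤s z≤n) , suc (4 ℕ.^ (8 * suc q)) , bound
  where
  a : ℕ
  a = pred (factor q m)
  instance
    factor≢0 : NonZero (factor q m)
    factor≢0 = m*n≢0 (16 * suc q * 2 ℕ.^ suc m) _
      {{m*n≢0 (16 * suc q) (2 ℕ.^ suc m) {{_}} {{m^n≢0 2 (suc m)}}}} {{m^n≢0 (32 * suc q) q}}
  C = frac 1 (2 + (a + a))
  bound : ∀ n → n ≥ suc (4 ℕ.^ (8 * suc q)) → ∀ {N} → Arrows G (K n n) N →
    fromℚ C *ᶜ (fromℕ n ÷ᶜ log n) ^ mkℚᵘ (ℤ.+ q) m <ᶜ fromℕ N
  bound n n≥ {N} arrows = scale-<ᶜ a {root (suc m) (Y ^ℕ q)} 0<N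
    (subst (λ z → Upper (root (suc m) (Y ^ℕ q)) (ι (z * N))) (sym (suc-pred (factor q m)))
      (Upper-root m {Y ^ℕ q} (*-mono-≤ (>-nonZero⁻¹ (factor q m)) 0<N)
        (Upper-^ℕ Y (n/log-upper ℓ>0 4^ℓ<n n<) q
          (large⇒power-≤ {b} {N} {q} {m} b>0 (arrows⇒large G eq par 0<n arrows)))))
    where
    par : Parameters q n
    par = parameters q n n≥
    open Parameters par
    Y = fromℕ n ÷ᶜ log n
    0<n : 0 ℕ.< n
    0<n = ≤-trans (s≤s z≤n) n≥
    0<N : 0 ℕ.< N
    0<N = arrows⇒>0 G 0<n arrows

-- The case distinction on `q` lets `exponent` compute to a fraction with a numerator of known sign.
lower-bound : ∀ {m} (G : Graph (3 + m)) (3≤p : 3 ≤ 3 + m) q → ∣E G ∣ ≡ q → LowerBound G (exponent 3≤p q)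
lower-bound G 3≤p zero    _  = edgeless G
lower-bound G 3≤p (suc q) eq = nonempty G eq

theorem1 : ∀ {p : ℕ} (G : Graph p) (bip : Bipartite G) (3≤p : 3 ≤ p) →
    ∃ λ (C : ℚᵘ) → 0ℚᵘ < C × ∃ λ (n₀ : ℕ) → ∀ (n : ℕ) → n ≥ n₀ →
    fromℚ C *ᶜ (fromℕ n ÷ᶜ log n) ^ exponent 3≤p ∣E G ∣
    <ᶜ fromℕ (br G (K n n) bip (K-bipartite n n))
theorem1 G bip 3≤p@(s≤s (s≤s (s≤s z≤n))) =
  let C , C>0 , n₀ , bound = lower-bound G 3≤p ∣E G ∣ refl
  in C , C>0 , n₀ , λ n n≥n₀ → bound n n≥n₀ (proj₁ (br-isLeast G (K n n) bip (K-bipartite n n)))
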